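{- Let $n\geq 3$ be a positive integer. Then: (1) $t(3,3,2)=2$, $t(4,3,2)=4$, and $t(5,3,2)=\binom{5}{2}$. Furthermore, when $n\geq 6$, there does not exist a connected graph $G$ of order $n$ such that $rx_3(G)\leq 2$. (2) $t(3,3,3)=2$, $t(4,3,3)=3$, and $t(5,3,3)=5$. Furthermore, when $n\geq 6$, $$t(n,3,3)\leq \begin{cases}\dfrac{n^2}{4}, & \text{if } n \text{ is even};\\[2mm] \dfrac{(n+3)(n-1)}{4}, & \text{if } n \text{ is odd}.\end{cases}$$
   Context: All graphs are finite, undirected and simple. Let $G$ be a nontrivial connected graph of order $n$ (i.e. with $n$ vertices). An edge-coloring of $G$ is any assignment of colors to the edges (adjacent edges may receive the same color). A tree $T$ that is a subgraph of $G$ is a rainbow tree if no two edges of $T$ have the same color. For $S\subseteq V(G)$ with $|S|\geq 2$, a rainbow $S$-tree is a rainbow tree $T$ in $G$ with $S\subseteq V(T)$. For an integer $k$ with $2\leq k\leq n$, an edge-coloring of $G$ is a $k$-rainbow coloring if for every $k$-subset $S$ of $V(G)$ there exists a rainbow $S$-tree. The $k$-rainbow index $rx_k(G)$ is the minimum number of colors needed in a $k$-rainbow coloring of $G$. For integers $2\leq k\leq n$ and $\ell\geq 2$, $t(n,k,\ell)$ denotes the minimum size (number of edges) of a connected graph $G$ of order $n$ with $rx_k(G)\leq \ell$ (when such a graph exists). -}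

module Defs where

open import Data.Bool using (Bool; true; false; T; T?)
open import Data.Fin using (Fin; _<?_)
open import Data.Fin.Subset using (Subset; _∈_; _⊆_; ∣_∣; Nonempty)
open import Data.List using (List; []; _∷_; _∷ʳ_; length; filter; allFin; cartesianProduct)
open import Data.List.Relation.Unary.Linked using (Linked)
open import Data.List.Relation.Unary.Unique.Propositional using (Unique)
open import Data.Nat using (ℕ; _≤_)
open import Data.Product using (Σ-syntax; ∃-syntax; _×_; _,_)
open import Data.Sum using (_⊎_)
open import Relation.Binary.Construct.Closure.ReflexiveTransitive using (Star)
open import Relation.Binary.PropositionalEquality using (_≡_)
open import Relation.Nullary using (¬_)
open import Relation.Nullary.Decidable using (_×-dec_)

record Graph (n : ℕ) : Set where
  field
    adj    : Fin n → Fin n → Bool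
    symm   : ∀ u v → adj u v ≡ adj v u
    irrefl : ∀ u → adj u u ≡ false

  Adj : Fin n → Fin n → Set
  Adj u v = T (adj u v)

  -- Each undirected edge {u , v} is listed once, as the pair with u < v.
  edges : List (Fin n × Fin n)
  edges = filter (λ (u , v) → (u <? v) ×-dec T? (adj u v))
                 (cartesianProduct (allFin n) (allFin n))

  size : ℕ
  size = length edges

infix 4 rx[_]_≤_ t[_,_,_]≡_ t[_,_,_]≤_

open Graph public using (Adj; size)

Connected : ∀ {n} → Graph n → Set
Connected G = ∀ u v → Star (Adj G) u v

-- A cycle is given by its at least three distinct vertices, in cyclic order.
Acyclic : ∀ {n} → Graph n → Set
Acyclic G = ∀ x y z zs → let c = x ∷ y ∷ z ∷ zs in
  Unique c → ¬ Linked (Adj G) (c ∷ʳ x)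

-- The edge set E is stored as a graph on all of Fin n; vertices outside V
-- are isolated in E and do not belong to the subgraph.
record Subgraph {n : ℕ} (G : Graph n) : Set where
  field
    V         : Subset n
    E         : Graph n
    E⊆G       : ∀ {u v} → Adj E u v → Adj G u v
    endpoints : ∀ {u v} → Adj E u v → u ∈ V × v ∈ V

open Subgraph public using (V; E)

record IsTree {n : ℕ} {G : Graph n} (H : Subgraph G) : Set where
  field
    nonempty  : Nonempty (V H)
    connected : ∀ {u v} → u ∈ V H → v ∈ V H → Star (Adj (E H)) u v
    acyclic   : Acyclic (E H)

-- A not necessarily proper edge-colouring with colours from Fin c.  The
-- function is total for convenience: its values off the edges are never used.
record EdgeColouring {n : ℕ} (G : Graph n) (c : ℕ) : Set where
  field
    colour : Fin n → Fin n → Fin c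
    symm   : ∀ u v → colour u v ≡ colour v u

open EdgeColouring public using (colour)

Rainbow : ∀ {n c} {G : Graph n} → EdgeColouring G c → Subgraph G → Set
Rainbow χ H = ∀ {u v x y} → Adj (E H) u v → Adj (E H) x y →
  colour χ u v ≡ colour χ x y → (u ≡ x × v ≡ y) ⊎ (u ≡ y × v ≡ x)

RainbowTree : ∀ {n c} {G : Graph n} → EdgeColouring G c → Subset n → Set
RainbowTree {G = G} χ S = Σ[ H ∈ Subgraph G ] IsTree H × Rainbow χ H × S ⊆ V H

IsRainbowColouring : ∀ {n c} {G : Graph n} → ℕ → EdgeColouring G c → Set
IsRainbowColouring {n} k χ = ∀ (S : Subset n) → ∣ S ∣ ≡ k → RainbowTree χ S

IsMinimum : (ℕ → Set) → ℕ → Set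
IsMinimum P m = P m × (∀ m′ → P m′ → m ≤ m′)

-- The minima rxₖ(G) and t(n,k,ℓ) are rendered as relations to their value.
-- They are meant for 2 ≤ k ≤ n, and t(n,k,ℓ) has no value when no suitable
-- graph exists; in particular "≤ b" includes the existence of the value.

IsRainbowIndex : ∀ {n} → ℕ → Graph n → ℕ → Set
IsRainbowIndex k G = IsMinimum λ c →
  Σ[ χ ∈ EdgeColouring G c ] IsRainbowColouring k χ

rx[_]_≤_ : ∀ {n} → ℕ → Graph n → ℕ → Set
rx[ k ] G ≤ ℓ = ∃[ r ] IsRainbowIndex k G r × r ≤ ℓ

t[_,_,_]≡_ : ℕ → ℕ → ℕ → ℕ → Set
t[ n , k , ℓ ]≡ m = IsMinimum
  (λ s → Σ[ G ∈ Graph n ] Connected G × rx[ k ] G ≤ ℓ × size G ≡ s) m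

t[_,_,_]≤_ : ℕ → ℕ → ℕ → ℕ → Set
t[ n , k , ℓ ]≤ b = ∃[ m ] t[ n , k , ℓ ]≡ m × m ≤ b

-- A rainbow tree is grown from a single vertex by adding leaves along edges of
-- unused colours, so the existence of a rainbow S-tree is decidable by a search
-- of bounded depth; hence all the minima exist as soon as one suitable graph does.
--
-- With two colours, every three vertices span edges of both colours.  Thus
-- neither "red" nor "not red" contains a triangle, and R(3,3) = 6 bounds n; for
-- n = 5 a missing edge uv would force a contradictory colour on some edge.
--
-- With three colours, two bridges always differ in colour: some triple has
-- vertices on both sides of each.  A tree with four edges therefore needs four
-- colours.  For n = 2m, colour x i — y j in the complete bipartite graph by the
-- order of i and j; for n = 2m + 1, add a vertex W joined to all x i by edges of
-- colour 1 and to all y i by edges of colour 2.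

module Submission where

open import Defs
open import Data.Nat using (ℕ; _+_; _*_; _∸_; _^_; _/_; _≤_)
open import Data.Nat.Combinatorics using (_C_)
open import Data.Nat.Divisibility using (_∣_)
open import Data.Product using (Σ-syntax; _×_)
open import Relation.Nullary using (¬_)

open import Data.Bool using (Bool; true; false; T; T?; _∨_; if_then_else_; not)
open import Data.Bool.Properties using (T-∨; ¬-not) renaming (_≟_ to _≟ᵇ_)
open import Data.Empty using (⊥)
open import Data.Fin as Fin using (Fin; zero; suc; toℕ; inject≤; punchIn; punchOut; splitAt; _↑ˡ_; _↑ʳ_; _<?_)
open import Data.Fin.Patterns using (0F; 1F; 2F)
open import Data.Fin.Properties as Fin using (any?; all?; _≟_; injective⇒≤; inject≤-injective; pigeonhole; punchIn-injective; punchInᵢ≢i; punchIn-punchOut; suc-injective; <-cmp; <-irrefl; <-trans; splitAt-↑ˡ; splitAt-↑ʳ; splitAt⁻¹-↑ˡ; splitAt⁻¹-↑ʳ; toℕ-↑ˡ; toℕ-↑ʳ)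
open import Data.Fin.Subset using (Subset; _∈_; _⊆_; ∣_∣; inside; outside; _∪_; ⁅_⁆) renaming (⊤ to full)
open import Data.Fin.Subset.Properties using (_∈?_; anySubset?; p⊆p∪q; q⊆p∪q; x∈⁅x⁆; ∣⁅x⁆∣≡1; s⊆s; ⊆⊤; ∣⊤∣≡n)
open import Data.List using (List; []; _∷_; [_]; _++_; _∷ʳ_; length; lookup; map; allFin; cartesianProduct; cartesianProductWith)
open import Data.List.Properties using (filter-≐; length-map; length-++; length-tabulate)
open import Data.List.Membership.Propositional using () renaming (_∈_ to _∈ˡ_; _∉_ to _∉ˡ_)
open import Data.List.Membership.Propositional.Properties using (∈-allFin; ∈-lookup; ∈-map⁺; ∈-filter⁻; ∈-cartesianProductWith⁺; ∈-++⁺ˡ; ∈-++⁺ʳ)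
import Data.List.Membership.DecPropositional as DecMembership
open import Data.List.Relation.Unary.All as All using (All; []; _∷_)
import Data.List.Relation.Unary.All.Properties as All
open import Data.List.Relation.Unary.AllPairs as AllPairs using (AllPairs; []; _∷_)
import Data.List.Relation.Unary.AllPairs.Properties as AllPairs
open import Data.List.Relation.Unary.Any using (here; there; index)
open import Data.List.Relation.Unary.Any.Properties using (lookup-index)
open import Data.List.Relation.Unary.Linked using (Linked; _∷_)
open import Data.List.Relation.Unary.Unique.Propositional using (Unique)
open import Data.List.Relation.Unary.Unique.Propositional.Properties using (allFin⁺; cartesianProduct⁺; filter⁺)
open import Data.Maybe using (Maybe; just; nothing; is-just; fromMaybe)
open import Data.Nat as ℕ using (zero; suc; _%_; z≤n; s≤s; z<s; s<s)
open import Data.Nat.Divisibility using (divides; m%n≡0⇒n∣m)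
open import Data.Nat.DivMod using (m≡m%n+[m/n]*n; m%n<n; m*n/n≡m)
import Data.Nat.Properties as ℕ
open import Data.Nat.Solver using (module +-*-Solver)
open import Data.Product using (∃; ∃₂; _,_; proj₁; proj₂; map₂)
open import Data.Sum using (_⊎_; inj₁; inj₂; [_,_]′; swap)
open import Data.Unit using (⊤; tt)
open import Data.Vec as Vec using (Vec; []; _∷_; here; there)
open import Data.Vec.Properties using (lookup∘tabulate; lookup⇒[]=; []=⇒lookup)
open import Function using (_∘_; const; id; mk⇔; Equivalence)
open import Relation.Binary.Construct.Closure.ReflexiveTransitive as Star using (Star; ε; _◅_; _◅◅_)
open import Relation.Binary.Definitions using (Tri; tri<; tri≈; tri>)
open import Relation.Binary.PropositionalEquality using (_≡_; _≢_; refl; sym; trans; cong; cong₂; subst; subst₂)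
open import Relation.Nullary using (Dec; yes; no; contradiction)
open import Relation.Nullary.Decidable using (map′; ¬?; _×-dec_; _⊎-dec_; _→-dec_; decidable-stable; does; does-⇔; dec-true; dec-false; from-yes)
open import Relation.Unary using (Decidable)

open Graph using (adj; symm; irrefl; edges)

-- Both `rx[_]_≤_` and `t[_,_,_]≤_` assert that a minimum exists, and constructively an inhabited
-- set of numbers has a least element only if membership can be decided. This shapes much of the
-- proof: graphs and colourings are functions, which cannot be enumerated up to equality, so they
-- are traded for symmetric matrices that agree with them pointwise, and colourability is shown to
-- survive the trade. The same search gives several lower bounds for small orders by inspecting all
-- adjacency matrices. It never has to run through all colourings there, because the colours are
-- removed beforehand by a general argument: bridges need distinct colours, or every triple spans
-- two edges. Separation is certified throughout by a two-valued function on the vertices that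
-- changes only across one edge. Such a certificate extends to a new leaf, yields acyclicity, and
-- forces that edge into every connected subgraph that meets both sides.

private
  variable
    A B D : Set
    k n c c′ ℓ b s : ℕ

-- Exhaustive search, and matrix forms of graphs

Searchable : Set → Set₁
Searchable A = {P : A → Set} → Decidable P → Dec (∃ P)

search-⊤ : Searchable ⊤
search-⊤ P? = map′ (tt ,_) proj₂ (P? tt)

search-Bool : Searchable Bool
search-Bool P? = map′ [ (true ,_) , (false ,_) ]′
  (λ { (true , p) → inj₁ p ; (false , p) → inj₂ p }) (P? true ⊎-dec P? false)

search-× : Searchable A → Searchable D → Searchable (A × D)
search-× a? d? P? = map′ (λ (a , d , p) → (a , d) , p) (λ ((a , d) , p) → a , d , p)
  (a? λ a → d? λ d → P? (a , d))

search-Vec : Searchable A → ∀ n → Searchable (Vec A n)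
search-Vec a? zero    P? = map′ ([] ,_) (λ { ([] , p) → p }) (P? [])
search-Vec a? (suc n) P? = map′ (λ (x , xs , p) → x ∷ xs , p) (λ { (x ∷ xs , p) → x , xs , p })
  (a? λ x → search-Vec a? n λ xs → P? (x ∷ xs))

every? : Searchable A → {P : A → Set} → Decidable P → Dec (∀ a → P a)
every? a? P? = map′ (λ ∄ a → decidable-stable (P? a) (λ ¬p → ∄ (a , ¬p)))
  (λ p (a , ¬p) → ¬p (p a)) (¬? (a? (¬? ∘ P?)))

-- The diagonal has its own type of entries: adjacency matrices carry no
-- information there, while colours of loops are arbitrary.
SymMatrix : Set → Set → ℕ → Set
SymMatrix D A zero    = ⊤
SymMatrix D A (suc n) = D × Vec A n × SymMatrix D A n

search-SymMatrix : Searchable D → Searchable A → ∀ n → Searchable (SymMatrix D A n)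
search-SymMatrix d? a? zero    = search-⊤
search-SymMatrix d? a? (suc n) =
  search-× d? (search-× (search-Vec a? n) (search-SymMatrix d? a? n))

entry : (D → A) → SymMatrix D A n → Fin n → Fin n → A
entry f (d , r , M) zero    zero    = f d
entry f (d , r , M) zero    (suc j) = Vec.lookup r j
entry f (d , r , M) (suc i) zero    = Vec.lookup r i
entry f (d , r , M) (suc i) (suc j) = entry f M i j

entry-symm : (f : D → A) (M : SymMatrix D A n) → ∀ i j → entry f M i j ≡ entry f M j i
entry-symm f M           zero    zero    = refl
entry-symm f M           zero    (suc j) = refl
entry-symm f M           (suc i) zero    = refl
entry-symm f (_ , _ , M) (suc i) (suc j) = entry-symm f M i j

matrix : (Fin n → D) → (Fin n → Fin n → A) → SymMatrix D A n
matrix {n = zero}  d g = tt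
matrix {n = suc n} d g =
  d zero , Vec.tabulate (g zero ∘ suc) , matrix (d ∘ suc) (λ i j → g (suc i) (suc j))

entry-matrix : {f : D → A} {d : Fin n → D} {g : Fin n → Fin n → A} →
  (∀ i → f (d i) ≡ g i i) → (∀ i j → g i j ≡ g j i) →
  ∀ i j → entry f (matrix d g) i j ≡ g i j
entry-matrix diag sym-g zero    zero    = diag zero
entry-matrix diag sym-g zero    (suc j) = lookup∘tabulate _ j
entry-matrix diag sym-g (suc i) zero    = trans (lookup∘tabulate _ i) (sym-g zero (suc i))
entry-matrix diag sym-g (suc i) (suc j) =
  entry-matrix (diag ∘ suc) (λ i j → sym-g (suc i) (suc j)) i j

Adjacency : ℕ → Set
Adjacency = SymMatrix ⊤ Bool

search-Adjacency : ∀ n → Searchable (Adjacency n)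
search-Adjacency = search-SymMatrix search-⊤ search-Bool

toGraph : Adjacency n → Graph n
toGraph M = record
  { adj = entry (const false) M ; symm = entry-symm (const false) M ; irrefl = loopless M }
  where
  loopless : (M : Adjacency n) → ∀ u → entry (const false) M u u ≡ false
  loopless M           zero    = refl
  loopless (_ , _ , M) (suc u) = loopless M u

infix 4 _≈_

-- Pointwise agreement stands in for equality: a graph and the graph of its matrix are records of
-- different functions, which are not provably equal without extensionality.
_≈_ : Graph n → Graph n → Set
G ≈ G′ = ∀ u v → adj G u v ≡ adj G′ u v

toAdjacency : Graph n → Adjacency n
toAdjacency G = matrix (const tt) (adj G)

≈-toGraph : (G : Graph n) → G ≈ toGraph (toAdjacency G)
≈-toGraph G u v = sym (entry-matrix (sym ∘ irrefl G) (symm G) u v)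

≈⇒Adj : {G G′ : Graph n} → G ≈ G′ → ∀ {u v} → Adj G u v → Adj G′ u v
≈⇒Adj G≈G′ = subst T (G≈G′ _ _)

size-cong : {G G′ : Graph n} → G ≈ G′ → size G ≡ size G′
size-cong {n = n} {G} {G′} G≈G′ = cong length (filter-≐
  (λ (u , v) → (u <? v) ×-dec T? (adj G u v)) (λ (u , v) → (u <? v) ×-dec T? (adj G′ u v))
  ( (λ (u<v , uv) → u<v , subst T (G≈G′ _ _) uv)
  , (λ (u<v , uv) → u<v , subst T (sym (G≈G′ _ _)) uv))
  (cartesianProduct (allFin n) (allFin n)))

-- A tree stays rainbow as long as the new colouring merges no two edge colours that the old one
-- distinguishes. This one principle covers a change of presentation of the graph, a colouring
-- replaced by its matrix, and an enlarged palette.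
map-RainbowTree : {G G′ : Graph n} (χ : EdgeColouring G c) (χ′ : EdgeColouring G′ c′) →
  (∀ {u v} → Adj G u v → Adj G′ u v) →
  (∀ {u v x y} → Adj G u v → Adj G x y →
    colour χ′ u v ≡ colour χ′ x y → colour χ u v ≡ colour χ x y) →
  ∀ {S} → RainbowTree χ S → RainbowTree χ′ S
map-RainbowTree χ χ′ G⊆G′ χ′⇒χ (H , tree , rainbow , S⊆H) =
  record { V = V H ; E = E H ; E⊆G = G⊆G′ ∘ Subgraph.E⊆G H ; endpoints = Subgraph.endpoints H } ,
  record { IsTree tree } ,
  (λ uv xy → rainbow uv xy ∘ χ′⇒χ (Subgraph.E⊆G H uv) (Subgraph.E⊆G H xy)) ,
  S⊆H

RainbowColourable : ℕ → Graph n → ℕ → Set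
RainbowColourable k G c = Σ[ χ ∈ EdgeColouring G c ] IsRainbowColouring k χ

colourable-cong : {G G′ : Graph n} → G ≈ G′ → RainbowColourable k G c → RainbowColourable k G′ c
colourable-cong {G = G} {G′} G≈G′ (χ , rc) =
  χ′ , λ S ∣S∣ → map-RainbowTree χ χ′ (≈⇒Adj {G = G} {G′} G≈G′) (λ _ _ → id) (rc S ∣S∣)
  where
  χ′ : EdgeColouring G′ _
  χ′ = record { EdgeColouring χ }

-- Bridges and acyclicity

Star-exit : {R : A → A → Set} {P : A → Set} → Decidable P →
  ∀ {a b} → Star R a b → P a → ¬ P b → ∃₂ λ x y → R x y × P x × ¬ P y
Star-exit P? ε        pa ¬pb = contradiction pa ¬pb
Star-exit P? (_◅_ {j = x} ax xb) pa ¬pb with P? x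
... | yes px = Star-exit P? xb px ¬pb
... | no ¬px = _ , x , ax , pa , ¬px

lookup-injective : {xs : List A} → Unique xs → ∀ {i j} → lookup xs i ≡ lookup xs j → i ≡ j
lookup-injective (_ ∷ _)         {zero}  {zero}  eq = refl
lookup-injective (x∉xs ∷ _)      {zero}  {suc j} eq = contradiction eq (All.lookup x∉xs (∈-lookup j))
lookup-injective (x∉xs ∷ _)      {suc i} {zero}  eq = contradiction (sym eq) (All.lookup x∉xs (∈-lookup i))
lookup-injective (_ ∷ uniq)      {suc i} {suc j} eq = cong suc (lookup-injective uniq eq)

Unique-⊆⇒length-≤ : {xs ys : List A} → Unique xs → (∀ {x} → x ∈ˡ xs → x ∈ˡ ys) →
  length xs ≤ length ys
Unique-⊆⇒length-≤ {xs = xs} {ys} uniq xs⊆ys = injective⇒≤ {f = position} λ {i} {j} eq →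
  lookup-injective uniq (trans (lookup-index (xs⊆ys (∈-lookup i)))
    (trans (cong (lookup ys) eq) (sym (lookup-index (xs⊆ys (∈-lookup j))))))
  where
  position : Fin (length xs) → Fin (length ys)
  position i = index (xs⊆ys (∈-lookup i))

SameEdge : Fin n → Fin n → Fin n → Fin n → Set
SameEdge u v x y = (u ≡ x × v ≡ y) ⊎ (u ≡ y × v ≡ x)

-- The values of `f` name the two sides that remain when the edge is removed. This form avoids
-- speaking about the graph without the edge.
IsBridge : Graph n → Fin n → Fin n → Set
IsBridge {n} G a b = Σ[ f ∈ (Fin n → Bool) ] f a ≢ f b ×
  (∀ {p q} → Adj G p q → f p ≢ f q → SameEdge p q a b)

-- Take the side function of the first edge `xy` of a cycle. The remaining walk from `y` back to `x`
-- never uses that edge again, so the function is constant along it and cannot separate `x` from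
-- `y`.
bridges⇒Acyclic : (G : Graph n) → (∀ {a b} → Adj G a b → IsBridge G a b) → Acyclic G
bridges⇒Acyclic G bridge x y z zs
  ((x≢y ∷ x≢z ∷ _) ∷ (y≢z ∷ y∉zs) ∷ _) (xy ∷ yz ∷ walk)
  with bridge xy
... | f , fx≢fy , only = fx≢fy (sym (trans fy≡fz (constant z zs walk (y≢z ∷ y∉zs))))
  where
  fy≡fz : f y ≡ f z
  fy≡fz = decidable-stable (f y ≟ᵇ f z) λ fy≢fz → case (only yz fy≢fz)
    where
    case : ¬ SameEdge y z x y
    case (inj₁ (y≡x , _)) = x≢y (sym y≡x)
    case (inj₂ (_ , z≡x)) = x≢z (sym z≡x)

  step : ∀ {p q} → Adj G p q → y ≢ p → y ≢ q → f p ≡ f q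
  step {p} {q} pq y≢p y≢q = decidable-stable (f p ≟ᵇ f q) λ fp≢fq → case (only pq fp≢fq)
    where
    case : ¬ SameEdge p q x y
    case (inj₁ (_ , q≡y)) = y≢q (sym q≡y)
    case (inj₂ (p≡y , _)) = y≢p (sym p≡y)

  constant : ∀ p ps → Linked (Adj G) ((p ∷ ps) ∷ʳ x) → All (y ≢_) (p ∷ ps) → f p ≡ f x
  constant p []       (px ∷ _)    (y≢p ∷ _)         = step px y≢p (x≢y ∘ sym)
  constant p (q ∷ ps) (pq ∷ walk) (y≢p ∷ y≢q ∷ y∉) =
    trans (step pq y≢p y≢q) (constant q ps walk (y≢q ∷ y∉))

T-does⁻ : (a? : Dec A) → T (does a?) → A
T-does⁻ (yes a) _ = a

T-does⁺ : (a? : Dec A) → A → T (does a?)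
T-does⁺ a? a = subst T (sym (dec-true a? a)) _

sameEdge? : ∀ (u v x y : Fin n) → Dec (SameEdge u v x y)
sameEdge? u v x y = (u ≟ x ×-dec v ≟ y) ⊎-dec (u ≟ y ×-dec v ≟ x)

SameEdge-euclidean : ∀ {u v x y a b : Fin n} →
  SameEdge u v a b → SameEdge x y a b → SameEdge u v x y
SameEdge-euclidean (inj₁ (refl , refl)) (inj₁ (refl , refl)) = inj₁ (refl , refl)
SameEdge-euclidean (inj₁ (refl , refl)) (inj₂ (refl , refl)) = inj₂ (refl , refl)
SameEdge-euclidean (inj₂ (refl , refl)) (inj₁ (refl , refl)) = inj₂ (refl , refl)
SameEdge-euclidean (inj₂ (refl , refl)) (inj₂ (refl , refl)) = inj₁ (refl , refl)

SameEdge-sym : ∀ {u v x y : Fin n} → SameEdge u v x y → SameEdge x y u v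
SameEdge-sym = SameEdge-euclidean (inj₁ (refl , refl))

SameEdge-trans : ∀ {u v x y a b : Fin n} → SameEdge u v x y → SameEdge x y a b → SameEdge u v a b
SameEdge-trans p q = SameEdge-euclidean p (SameEdge-sym q)

Adj-sym : (G : Graph n) → ∀ {u v} → Adj G u v → Adj G v u
Adj-sym G = subst T (symm G _ _)

Adj⇒≢ : (G : Graph n) → ∀ {u v} → Adj G u v → u ≢ v
Adj⇒≢ G uu refl = subst T (irrefl G _) uu

emptyGraph : Graph n
emptyGraph = record { adj = λ _ _ → false ; symm = λ _ _ → refl ; irrefl = λ _ → refl }

addEdge : Graph n → ∀ u w → u ≢ w → Graph n
addEdge E u w u≢w = record
  { adj    = λ a b → adj E a b ∨ does (sameEdge? a b u w)
  ; symm   = λ a b → cong₂ _∨_ (symm E a b)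
      (does-⇔ (mk⇔ reverse reverse) (sameEdge? a b u w) (sameEdge? b a u w))
  ; irrefl = λ a → cong₂ _∨_ (irrefl E a) (dec-false (sameEdge? a a u w) loop)
  }
  where
  reverse : ∀ {a b} → SameEdge a b u w → SameEdge b a u w
  reverse (inj₁ (p , q)) = inj₂ (q , p)
  reverse (inj₂ (p , q)) = inj₁ (q , p)
  loop : ∀ {a} → ¬ SameEdge a a u w
  loop (inj₁ (p , q)) = u≢w (trans (sym p) q)
  loop (inj₂ (p , q)) = u≢w (trans (sym q) p)

-- Rainbow trees grown leaf by leaf, and their decidability

module Growth {n c : ℕ} {G : Graph n} (χ : EdgeColouring G c) where

  data RainbowGrowth : List (Fin n) → List (Fin c) → Set where
    root : ∀ r → RainbowGrowth [ r ] []
    grow : ∀ {vs cs u w} → RainbowGrowth vs cs → u ∈ˡ vs → w ∉ˡ vs → Adj G u w →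
           colour χ u w ∉ˡ cs → RainbowGrowth (w ∷ vs) (colour χ u w ∷ cs)

  open DecMembership (_≟_ {n}) using () renaming (_∈?_ to _∈ᵛ?_)
  open DecMembership (_≟_ {c}) using () renaming (_∈?_ to _∈ᶜ?_)

  colour-SameEdge : ∀ {u v x y} → SameEdge u v x y → colour χ u v ≡ colour χ x y
  colour-SameEdge (inj₁ (refl , refl)) = refl
  colour-SameEdge (inj₂ (refl , refl)) = EdgeColouring.symm χ _ _

  -- The invariant carries bridges instead of acyclicity: a statement about all cycles is awkward to
  -- push through the addition of a leaf, whereas a side function is easily extended to the new
  -- vertex.
  record Grown (vs : List (Fin n)) (cs : List (Fin c)) : Set where
    field
      tree      : Graph n
      tree⊆G    : ∀ {u v} → Adj tree u v → Adj G u v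
      endpoints : ∀ {u v} → Adj tree u v → u ∈ˡ vs × v ∈ˡ vs
      colours   : ∀ {u v} → Adj tree u v → colour χ u v ∈ˡ cs
      connected : ∀ {u v} → u ∈ˡ vs → v ∈ˡ vs → Star (Adj tree) u v
      bridges   : ∀ {u v} → Adj tree u v → IsBridge tree u v
      rainbow   : ∀ {u v x y} → Adj tree u v → Adj tree x y →
                  colour χ u v ≡ colour χ x y → SameEdge u v x y

  grown : ∀ {vs cs} → RainbowGrowth vs cs → Grown vs cs
  grown (root r) = record
    { tree      = emptyGraph
    ; tree⊆G    = λ ()
    ; endpoints = λ ()
    ; colours   = λ ()
    ; connected = λ { (here refl) (here refl) → ε }
    ; bridges   = λ ()
    ; rainbow   = λ ()
    }
  grown (grow {vs} {cs} {u} {w} growth u∈vs w∉vs uw new-colour) = record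
    { tree      = E′
    ; tree⊆G    = λ ab → tree⊆G′ (split ab)
    ; endpoints = λ ab → endpoints′ (split ab)
    ; colours   = λ ab → colours′ (split ab)
    ; connected = connected′
    ; bridges   = λ ab → bridges′ (split ab)
    ; rainbow   = λ ab xy → rainbow′ (split ab) (split xy)
    }
    where
    open Grown (grown growth)

    E′ : Graph n
    E′ = addEdge tree u w (Adj⇒≢ G uw)

    split : ∀ {a b} → Adj E′ a b → Adj tree a b ⊎ SameEdge a b u w
    split {a} {b} ab with Equivalence.to (T-∨ {adj tree a b}) ab
    ... | inj₁ old = inj₁ old
    ... | inj₂ new = inj₂ (T-does⁻ (sameEdge? a b u w) new)

    old : ∀ {a b} → Adj tree a b → Adj E′ a b
    old = Equivalence.from T-∨ ∘ inj₁

    uw′ : Adj E′ u w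
    uw′ = Equivalence.from (T-∨ {adj tree u w})
      (inj₂ (T-does⁺ (sameEdge? u w u w) (inj₁ (refl , refl))))

    tree⊆G′ : ∀ {a b} → Adj tree a b ⊎ SameEdge a b u w → Adj G a b
    tree⊆G′ (inj₁ ab)                   = tree⊆G ab
    tree⊆G′ (inj₂ (inj₁ (refl , refl))) = uw
    tree⊆G′ (inj₂ (inj₂ (refl , refl))) = Adj-sym G uw

    endpoints′ : ∀ {a b} → Adj tree a b ⊎ SameEdge a b u w → a ∈ˡ w ∷ vs × b ∈ˡ w ∷ vs
    endpoints′ (inj₁ ab) = there (proj₁ (endpoints ab)) , there (proj₂ (endpoints ab))
    endpoints′ (inj₂ (inj₁ (refl , refl))) = there u∈vs , here refl
    endpoints′ (inj₂ (inj₂ (refl , refl))) = here refl , there u∈vs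

    colours′ : ∀ {a b} → Adj tree a b ⊎ SameEdge a b u w → colour χ a b ∈ˡ colour χ u w ∷ cs
    colours′ (inj₁ ab) = there (colours ab)
    colours′ (inj₂ ab) = here (colour-SameEdge ab)

    connected′ : ∀ {a b} → a ∈ˡ w ∷ vs → b ∈ˡ w ∷ vs → Star (Adj E′) a b
    connected′ (here refl) (here refl) = ε
    connected′ (here refl) (there b∈)  = Adj-sym E′ uw′ ◅ Star.map old (connected u∈vs b∈)
    connected′ (there a∈)  (here refl) = Star.map old (connected a∈ u∈vs) ◅◅ uw′ ◅ ε
    connected′ (there a∈)  (there b∈)  = Star.map old (connected a∈ b∈)

    rainbow′ : ∀ {a b x y} → Adj tree a b ⊎ SameEdge a b u w → Adj tree x y ⊎ SameEdge x y u w →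
      colour χ a b ≡ colour χ x y → SameEdge a b x y
    rainbow′ (inj₁ ab) (inj₁ xy) eq = rainbow ab xy eq
    rainbow′ (inj₁ ab) (inj₂ xy) eq =
      contradiction (subst (_∈ˡ cs) (trans eq (colour-SameEdge xy)) (colours ab)) new-colour
    rainbow′ (inj₂ ab) (inj₁ xy) eq =
      contradiction (subst (_∈ˡ cs) (trans (sym eq) (colour-SameEdge ab)) (colours xy)) new-colour
    rainbow′ (inj₂ ab) (inj₂ xy) eq = SameEdge-euclidean ab xy

    ≢w : ∀ {x} → x ∈ˡ vs → x ≢ w
    ≢w x∈vs refl = w∉vs x∈vs

    new-bridge : IsBridge E′ u w
    new-bridge = isw , u≢w , λ pq → only (split pq)
      where
      isw : Fin n → Bool
      isw x = does (x ≟ w)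
      old-false : ∀ {x} → x ∈ˡ vs → isw x ≡ false
      old-false x∈vs = dec-false (_ ≟ w) (≢w x∈vs)
      u≢w : isw u ≢ isw w
      u≢w eq with () ← trans (sym (old-false u∈vs)) (trans eq (dec-true (w ≟ w) refl))
      only : ∀ {p q} → Adj tree p q ⊎ SameEdge p q u w → isw p ≢ isw q → SameEdge p q u w
      only (inj₁ pq) p≢q = contradiction
        (trans (old-false (proj₁ (endpoints pq))) (sym (old-false (proj₂ (endpoints pq))))) p≢q
      only (inj₂ pq) _   = pq

    bridges′ : ∀ {a b} → Adj tree a b ⊎ SameEdge a b u w → IsBridge E′ a b
    bridges′ (inj₂ (inj₁ (refl , refl))) = new-bridge
    bridges′ (inj₂ (inj₂ (refl , refl))) =
      map₂ (λ (u≢w , only) → u≢w ∘ sym , λ pq p≢q → swap (only pq p≢q)) new-bridge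
    bridges′ {a} {b} (inj₁ ab) with bridges ab
    ... | f , fa≢fb , only = f′ , a≢b , λ pq → only′ (split pq)
      where
      f′ : Fin n → Bool
      -- The leaf inherits the side of its neighbour, so the new edge does not cross the old cut.
      f′ x = if does (x ≟ w) then f u else f x
      f′-old : ∀ {x} → x ∈ˡ vs → f′ x ≡ f x
      f′-old {x} x∈vs = cong (λ b → if b then f u else f x) (dec-false (x ≟ w) (≢w x∈vs))
      f′-uw : f′ u ≡ f′ w
      f′-uw = trans (f′-old u∈vs) (sym (cong (λ b → if b then f u else f w) (dec-true (w ≟ w) refl)))
      a≢b : f′ a ≢ f′ b
      a≢b eq = fa≢fb (trans (sym (f′-old (proj₁ (endpoints ab))))
                     (trans eq (f′-old (proj₂ (endpoints ab)))))
      only′ : ∀ {p q} → Adj tree p q ⊎ SameEdge p q u w → f′ p ≢ f′ q → SameEdge p q a b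
      only′ (inj₁ pq) p≢q = only pq λ eq → p≢q
        (trans (f′-old (proj₁ (endpoints pq))) (trans eq (sym (f′-old (proj₂ (endpoints pq))))))
      only′ (inj₂ (inj₁ (refl , refl))) p≢q = contradiction f′-uw p≢q
      only′ (inj₂ (inj₂ (refl , refl))) p≢q = contradiction (sym f′-uw) p≢q

  root∈ : ∀ {vs cs} → RainbowGrowth vs cs → ∃ (_∈ˡ vs)
  root∈ (root r)           = r , here refl
  root∈ (grow _ u∈vs _ _ _) = _ , there u∈vs

  RainbowGrowth⇒RainbowTree : ∀ {S vs cs} → RainbowGrowth vs cs → (∀ {x} → x ∈ S → x ∈ˡ vs) →
    RainbowTree χ S
  RainbowGrowth⇒RainbowTree {vs = vs} growth S⊆vs = H , isTree , rainbow , (λ x∈S → ∈-V⁺ (S⊆vs x∈S))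
    where
    open Grown (grown growth)
    member : Fin n → Bool
    member x = does (x ∈ᵛ? vs)
    ∈-V⁺ : ∀ {x} → x ∈ˡ vs → x ∈ Vec.tabulate member
    ∈-V⁺ {x} x∈vs = lookup⇒[]= x _ (trans (lookup∘tabulate member x) (dec-true (x ∈ᵛ? vs) x∈vs))
    ∈-V⁻ : ∀ {x} → x ∈ Vec.tabulate member → x ∈ˡ vs
    ∈-V⁻ {x} x∈V = T-does⁻ (x ∈ᵛ? vs)
      (subst T (sym (trans (sym (lookup∘tabulate member x)) ([]=⇒lookup x∈V))) _)
    H : Subgraph G
    H = record
      { V         = Vec.tabulate member
      ; E         = tree
      ; E⊆G       = tree⊆G
      ; endpoints = λ uv → ∈-V⁺ (proj₁ (endpoints uv)) , ∈-V⁺ (proj₂ (endpoints uv))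
      }
    isTree : IsTree H
    isTree = record
      { nonempty  = map₂ ∈-V⁺ (root∈ growth)
      ; connected = λ u∈V v∈V → connected (∈-V⁻ u∈V) (∈-V⁻ v∈V)
      ; acyclic   = bridges⇒Acyclic tree bridges
      }

  Extends : Subset n → ℕ → List (Fin n) → List (Fin c) → Set
  Extends S zero    vs cs = ∀ x → x ∈ S → x ∈ˡ vs
  Extends S (suc k) vs cs = (∀ x → x ∈ S → x ∈ˡ vs) ⊎ ∃₂ λ u w →
    u ∈ˡ vs × w ∉ˡ vs × Adj G u w × colour χ u w ∉ˡ cs × Extends S k (w ∷ vs) (colour χ u w ∷ cs)

  covers? : ∀ S vs → Dec (∀ x → x ∈ S → x ∈ˡ vs)
  covers? S vs = all? λ x → (x ∈? S) →-dec (x ∈ᵛ? vs)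

  extends? : ∀ S k vs cs → Dec (Extends S k vs cs)
  extends? S zero    vs cs = covers? S vs
  extends? S (suc k) vs cs = covers? S vs ⊎-dec any? λ u → any? λ w →
    (u ∈ᵛ? vs) ×-dec ¬? (w ∈ᵛ? vs) ×-dec T? (adj G u w) ×-dec ¬? (colour χ u w ∈ᶜ? cs)
    ×-dec extends? S k (w ∷ vs) (colour χ u w ∷ cs)

  Extends⇒RainbowTree : ∀ {S} k {vs cs} → RainbowGrowth vs cs → Extends S k vs cs → RainbowTree χ S
  Extends⇒RainbowTree zero    growth covers = RainbowGrowth⇒RainbowTree growth (covers _)
  Extends⇒RainbowTree (suc k) growth (inj₁ covers) = RainbowGrowth⇒RainbowTree growth (covers _)
  Extends⇒RainbowTree (suc k) growth (inj₂ (u , w , u∈vs , w∉vs , uw , new , extends)) =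
    Extends⇒RainbowTree k (grow growth u∈vs w∉vs uw new) extends

  -- The given tree guides the search. If some vertex of `S` is still missing, a path of the tree
  -- towards it leaves `vs` along an edge `uw`. All colours used so far come from tree edges inside
  -- `vs`, so the colour of `uw` is new. The fuel `k` cannot run out, since `vs` would then hold
  -- `n + 1` distinct vertices.
  RainbowTree⇒Extends : ∀ {S} ((H , _) : RainbowTree χ S) k {vs cs} → k + length vs ≡ suc n →
    Unique vs → ∃ (_∈ˡ vs) → (∀ {v} → v ∈ˡ vs → v ∈ V H) →
    (∀ {κ} → κ ∈ˡ cs → ∃₂ λ a b → a ∈ˡ vs × b ∈ˡ vs × Adj (E H) a b × κ ≡ colour χ a b) →
    Extends S k vs cs
  RainbowTree⇒Extends t zero {vs} size uniq _ _ _ = contradiction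
    (subst₂ _≤_ size (length-tabulate id) (Unique-⊆⇒length-≤ uniq (λ {x} _ → ∈-allFin x))) ℕ.1+n≰n
  RainbowTree⇒Extends {S} t@(H , isTree , rainbow , S⊆V) (suc k) {vs} {cs} size uniq (r , r∈vs) vs⊆V used
    with any? (λ s → (s ∈? S) ×-dec ¬? (s ∈ᵛ? vs))
  ... | no  ∄s = inj₁ λ x x∈S → decidable-stable (x ∈ᵛ? vs) λ x∉vs → ∄s (x , x∈S , x∉vs)
  ... | yes (s , s∈S , s∉vs)
    with Star-exit (_∈ᵛ? vs) (IsTree.connected isTree (vs⊆V r∈vs) (S⊆V s∈S)) r∈vs s∉vs
  ... | u , w , uw , u∈vs , w∉vs = inj₂ (u , w , u∈vs , w∉vs , Subgraph.E⊆G H uw , new-colour ,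
      RainbowTree⇒Extends t k (trans (ℕ.+-suc k (length vs)) size)
        (All.¬Any⇒All¬ vs w∉vs ∷ uniq) (r , there r∈vs) vs⊆V′ used′)
    where
    new-colour : colour χ u w ∉ˡ cs
    new-colour κ∈cs with used κ∈cs
    ... | a , b , a∈vs , b∈vs , ab , eq with rainbow uw ab eq
    ... | inj₁ (refl , refl) = w∉vs b∈vs
    ... | inj₂ (refl , refl) = w∉vs a∈vs
    vs⊆V′ : ∀ {v} → v ∈ˡ w ∷ vs → v ∈ V H
    vs⊆V′ (here refl) = proj₂ (Subgraph.endpoints H uw)
    vs⊆V′ (there v∈)  = vs⊆V v∈
    used′ : ∀ {κ} → κ ∈ˡ colour χ u w ∷ cs →
      ∃₂ λ a b → a ∈ˡ w ∷ vs × b ∈ˡ w ∷ vs × Adj (E H) a b × κ ≡ colour χ a b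
    used′ (here refl) = u , w , there u∈vs , here refl , uw , refl
    used′ (there κ∈) with used κ∈
    ... | a , b , a∈ , b∈ , rest = a , b , there a∈ , there b∈ , rest

  rainbowTree? : ∀ S → Dec (RainbowTree χ S)
  rainbowTree? S = map′ sound complete (any? λ r → extends? S n [ r ] [])
    where
    sound : (∃ λ r → Extends S n [ r ] []) → RainbowTree χ S
    sound (r , extends) = Extends⇒RainbowTree n (root r) extends
    complete : RainbowTree χ S → ∃ λ r → Extends S n [ r ] []
    complete t@(_ , isTree , _) with IsTree.nonempty isTree
    ... | r , r∈V = r , RainbowTree⇒Extends t n (ℕ.+-comm n 1) ([] ∷ []) (r , here refl)
      (λ { (here refl) → r∈V }) (λ ())

  isRainbowColouring? : ∀ k → Dec (IsRainbowColouring k χ)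
  isRainbowColouring? k =
    every? (search-Vec search-Bool n) (λ S → (∣ S ∣ ℕ.≟ k) →-dec rainbowTree? S)

open Growth

colourable? : ∀ k (G : Graph n) c → Dec (RainbowColourable k G c)
colourable? {n} k G c = map′ (λ (M , rc) → colouring M , rc) complete
  (search-SymMatrix any? any? n λ M → isRainbowColouring? (colouring M) k)
  where
  colouring : SymMatrix (Fin c) (Fin c) n → EdgeColouring G c
  colouring M = record { colour = entry id M ; symm = entry-symm id M }
  complete : RainbowColourable k G c → ∃ λ M → IsRainbowColouring k (colouring M)
  complete (χ , rc) = M , λ S ∣S∣ → map-RainbowTree χ (colouring M) id
    (λ _ _ eq → trans (sym (agree _ _)) (trans eq (agree _ _))) (rc S ∣S∣)
    where
    M : SymMatrix (Fin c) (Fin c) n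
    M = matrix (λ u → colour χ u u) (colour χ)
    agree : ∀ u v → entry id M u v ≡ colour χ u v
    agree = entry-matrix (λ _ → refl) (EdgeColouring.symm χ)

-- Existence of minima

least : {P : ℕ → Set} → Decidable P → P b → ∃ λ m → IsMinimum P m × m ≤ b
least {b} {P} P? pb = from b 0 (ℕ.+-identityʳ b) λ _ _ → z≤n
  where
  from : ∀ k m → k + m ≡ b → (∀ j → P j → m ≤ j) → ∃ λ m → IsMinimum P m × m ≤ b
  from k m eq below with P? m
  from k m refl below | yes pm = m , (pm , below) , ℕ.m≤n+m m k
  -- With no fuel left, `m` is `b` itself, where `P` is known to hold.
  from zero m refl below | no ¬pm = contradiction pb ¬pm
  from (suc k) m eq below | no ¬pm = from k (suc m) (trans (ℕ.+-suc k m) eq)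
    λ j pj → ℕ.≤∧≢⇒< (below j pj) λ { refl → ¬pm pj }

colourable⇒rx≤ : (G : Graph n) → RainbowColourable k G ℓ → rx[ k ] G ≤ ℓ
colourable⇒rx≤ {k = k} G colourable = least (colourable? k G) colourable

colourable-mono : {G : Graph n} → c ≤ c′ → RainbowColourable k G c → RainbowColourable k G c′
colourable-mono {c′ = c′} {G = G} c≤c′ (χ , rc) =
  χ′ , λ S ∣S∣ → map-RainbowTree χ χ′ id (λ _ _ → inject≤-injective c≤c′ c≤c′ _ _) (rc S ∣S∣)
  where
  χ′ : EdgeColouring G c′
  χ′ = record
    { colour = λ u v → inject≤ (colour χ u v) c≤c′
    ; symm   = λ u v → cong (λ κ → inject≤ κ c≤c′) (EdgeColouring.symm χ u v)
    }

-- Together with `colourable⇒rx≤` this allows every bound on the rainbow index to be read as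
-- colourability with `ℓ` available colours, without mention of a minimum.
rx≤⇒colourable : {G : Graph n} → rx[ k ] G ≤ ℓ → RainbowColourable k G ℓ
rx≤⇒colourable (c , (colourable , _) , c≤ℓ) = colourable-mono c≤ℓ colourable

-- Trees through three vertices, and attainable sizes

∣p∪q∣≤∣p∣+∣q∣ : ∀ (p q : Subset n) → ∣ p ∪ q ∣ ≤ ∣ p ∣ + ∣ q ∣
∣p∪q∣≤∣p∣+∣q∣ []            []            = z≤n
∣p∪q∣≤∣p∣+∣q∣ (outside ∷ p) (outside ∷ q) = ∣p∪q∣≤∣p∣+∣q∣ p q
∣p∪q∣≤∣p∣+∣q∣ (outside ∷ p) (inside ∷ q)  =
  subst (suc ∣ p ∪ q ∣ ≤_) (sym (ℕ.+-suc ∣ p ∣ ∣ q ∣)) (s≤s (∣p∪q∣≤∣p∣+∣q∣ p q))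
∣p∪q∣≤∣p∣+∣q∣ (inside ∷ p)  (outside ∷ q) = s≤s (∣p∪q∣≤∣p∣+∣q∣ p q)
∣p∪q∣≤∣p∣+∣q∣ (inside ∷ p)  (inside ∷ q)  =
  s≤s (ℕ.≤-trans (∣p∪q∣≤∣p∣+∣q∣ p q) (ℕ.+-monoʳ-≤ ∣ p ∣ (ℕ.n≤1+n ∣ q ∣)))

enlarge : (S : Subset n) → ∣ S ∣ ≤ k → k ≤ n → ∃ λ S′ → S ⊆ S′ × ∣ S′ ∣ ≡ k
enlarge []           _         z≤n       = [] , id , refl
enlarge (inside ∷ S) (s≤s S≤k) (s≤s k≤n) with enlarge S S≤k k≤n
... | S′ , S⊆S′ , ∣S′∣ = inside ∷ S′ , s⊆s S⊆S′ , cong suc ∣S′∣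
enlarge {k = k} (_∷_ {n} outside S) S≤k k≤1+n with k ℕ.≤? n
... | no k≰n = full , ⊆⊤ , trans (∣⊤∣≡n (suc n)) (ℕ.≤-antisym (ℕ.≰⇒> k≰n) k≤1+n)
... | yes k≤n with enlarge S S≤k k≤n
... | S′ , S⊆S′ , ∣S′∣ = outside ∷ S′ , s⊆s S⊆S′ , ∣S′∣

-- Repetitions are allowed on purpose: a triple such as `p`, `p`, `q` yields a rainbow tree through
-- two prescribed vertices. The set is padded to exactly three elements.
triple : 3 ≤ n → (x y z : Fin n) → ∃ λ S → ∣ S ∣ ≡ 3 × x ∈ S × y ∈ S × z ∈ S
triple 3≤n x y z with enlarge (⁅ x ⁆ ∪ (⁅ y ⁆ ∪ ⁅ z ⁆)) ∣xyz∣≤3 3≤n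
  where
  ∣xyz∣≤3 : ∣ ⁅ x ⁆ ∪ (⁅ y ⁆ ∪ ⁅ z ⁆) ∣ ≤ 3
  ∣xyz∣≤3 = ℕ.≤-trans (∣p∪q∣≤∣p∣+∣q∣ ⁅ x ⁆ _) (ℕ.+-mono-≤ (ℕ.≤-reflexive (∣⁅x⁆∣≡1 x))
    (ℕ.≤-trans (∣p∪q∣≤∣p∣+∣q∣ ⁅ y ⁆ ⁅ z ⁆)
      (ℕ.+-mono-≤ (ℕ.≤-reflexive (∣⁅x⁆∣≡1 y)) (ℕ.≤-reflexive (∣⁅x⁆∣≡1 z)))))
... | S , xyz⊆S , ∣S∣ = S , ∣S∣ , xyz⊆S (p⊆p∪q _ (x∈⁅x⁆ x)) ,
  xyz⊆S (q⊆p∪q ⁅ x ⁆ _ (p⊆p∪q _ (x∈⁅x⁆ y))) , xyz⊆S (q⊆p∪q ⁅ x ⁆ _ (q⊆p∪q ⁅ y ⁆ _ (x∈⁅x⁆ z)))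

record RainbowTreeThrough {G : Graph n} (χ : EdgeColouring G c) (x y z : Fin n) : Set where
  field
    H       : Subgraph G
    isTree  : IsTree H
    rainbow : Rainbow χ H
    x∈      : x ∈ V H
    y∈      : y ∈ V H
    z∈      : z ∈ V H

treeThrough : 3 ≤ n → {G : Graph n} (χ : EdgeColouring G c) → IsRainbowColouring 3 χ →
  ∀ x y z → RainbowTreeThrough χ x y z
treeThrough 3≤n χ rc x y z with triple 3≤n x y z
... | S , ∣S∣ , x∈S , y∈S , z∈S with rc S ∣S∣
... | H , isTree , rainbow , S⊆V = record
  { H = H ; isTree = isTree ; rainbow = rainbow ; x∈ = S⊆V x∈S ; y∈ = S⊆V y∈S ; z∈ = S⊆V z∈S }

colourable⇒Connected : 3 ≤ n → {G : Graph n} → RainbowColourable 3 G c → Connected G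
colourable⇒Connected 3≤n (χ , rc) u v =
  Star.map (Subgraph.E⊆G H) (IsTree.connected isTree x∈ z∈)
  where open RainbowTreeThrough (treeThrough 3≤n χ rc u u v)

Attains : ℕ → ℕ → ℕ → ℕ → Set
Attains n k ℓ s = Σ[ G ∈ Graph n ] Connected G × rx[ k ] G ≤ ℓ × size G ≡ s

attains : 3 ≤ n → (G : Graph n) → RainbowColourable 3 G ℓ → Attains n 3 ℓ (size G)
attains 3≤n G colourable =
  G , colourable⇒Connected 3≤n colourable , colourable⇒rx≤ G colourable , refl

-- Once every witness is in matrix form, both the decision procedure and the lower bounds need to
-- range over matrices only.
attains⁻ : Attains n 3 ℓ s → ∃ λ M → RainbowColourable 3 (toGraph {n} M) ℓ × size (toGraph M) ≡ s
attains⁻ {n} {ℓ} (G , _ , rx , eq) =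
  M , colourable-cong {G = G} {toGraph M} G≈M (rx≤⇒colourable rx) ,
  trans (sym (size-cong {G = G} {toGraph M} G≈M)) eq
  where
  M = toAdjacency G
  G≈M = ≈-toGraph G

attains? : 3 ≤ n → ∀ s → Dec (Attains n 3 ℓ s)
attains? {n} {ℓ} 3≤n s = map′ sound attains⁻
  (search-Adjacency n λ M → colourable? 3 (toGraph M) ℓ ×-dec (size (toGraph M) ℕ.≟ s))
  where
  sound : (∃ λ M → RainbowColourable 3 (toGraph {n} M) ℓ × size (toGraph M) ≡ s) → Attains n 3 ℓ s
  sound (M , colourable , refl) = attains 3≤n (toGraph M) colourable

t≤ : 3 ≤ n → (G : Graph n) → RainbowColourable 3 G ℓ → size G ≤ b → t[ n , 3 , ℓ ]≤ b
t≤ 3≤n G colourable size≤b with least (attains? 3≤n) (attains 3≤n G colourable)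
... | m , minimum , m≤size = m , minimum , ℕ.≤-trans m≤size size≤b

-- Bridges need distinct colours

edges-Unique : (G : Graph n) → Unique (edges G)
edges-Unique {n} G = filter⁺ _ (cartesianProduct⁺ (allFin⁺ n) (allFin⁺ n))

∈-edges⁻ : (G : Graph n) → ∀ {u v} → (u , v) ∈ˡ edges G → u Fin.< v × Adj G u v
∈-edges⁻ {n} G e = proj₂ (∈-filter⁻ (λ (u , v) → (u <? v) ×-dec T? (adj G u v))
  {xs = cartesianProduct (allFin n) (allFin n)} e)

-- Suppose the two edges differ. Each then lies on one side of the other's cut, so some end of `uv`
-- is across from `xy` for `f`, and some end of `xy` is across from `uv` for `g`. These two ends are
-- separated by both functions, so a rainbow tree through them contains both bridges, which
-- therefore cannot share a colour.
bridges-differ : 3 ≤ n → {G : Graph n} (χ : EdgeColouring G c) → IsRainbowColouring 3 χ →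
  ∀ {u v x y} → Adj G u v → IsBridge G u v → Adj G x y → IsBridge G x y →
  colour χ u v ≡ colour χ x y → SameEdge u v x y
bridges-differ {n} 3≤n {G} χ rc {u} {v} {x} {y} uv (f , fu≢fv , only-uv) xy (g , gx≢gy , only-xy) same =
  decidable-stable (sameEdge? u v x y) impossible
  where
  far : (h : Fin n → Bool) → ∀ {a b} → h a ≢ h b → ∀ β → (h a ≢ β) ⊎ (h b ≢ β)
  far h {a} {b} ha≢hb β with h a ≟ᵇ β
  ... | no ha≢β = inj₁ ha≢β
  ... | yes ha≡β = inj₂ λ hb≡β → ha≢hb (trans ha≡β (sym hb≡β))

  separated : ∀ {p q} → f p ≢ f q → g p ≢ g q → SameEdge u v x y
  separated {p} {q} fp≢fq gp≢gq
    with Star-exit (λ a → f a ≟ᵇ f p) (IsTree.connected isTree x∈ z∈) refl (fp≢fq ∘ sym)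
       | Star-exit (λ a → g a ≟ᵇ g p) (IsTree.connected isTree x∈ z∈) refl (gp≢gq ∘ sym)
    where open RainbowTreeThrough (treeThrough 3≤n χ rc p p q)
  ... | a , b , ab , fa≡fp , fb≢fp | d , e , de , gd≡gp , ge≢gp =
    SameEdge-trans (SameEdge-sym ab∼uv) (SameEdge-trans ab∼de de∼xy)
    where
    open RainbowTreeThrough (treeThrough 3≤n χ rc p p q)
    ab∼uv : SameEdge a b u v
    ab∼uv = only-uv (Subgraph.E⊆G H ab) λ fa≡fb → fb≢fp (trans (sym fa≡fb) fa≡fp)
    de∼xy : SameEdge d e x y
    de∼xy = only-xy (Subgraph.E⊆G H de) λ gd≡ge → ge≢gp (trans (sym gd≡ge) gd≡gp)
    ab∼de : SameEdge a b d e
    ab∼de = rainbow ab de (trans (colour-SameEdge χ ab∼uv)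
      (trans same (sym (colour-SameEdge χ de∼xy))))

  impossible : ¬ ¬ SameEdge u v x y
  impossible uv≁xy = case (far f fu≢fv (f x)) (far g gx≢gy (g u))
    where
    fx≡fy : f x ≡ f y
    fx≡fy = decidable-stable (f x ≟ᵇ f y) λ fx≢fy → uv≁xy (SameEdge-sym (only-uv xy fx≢fy))
    gu≡gv : g u ≡ g v
    gu≡gv = decidable-stable (g u ≟ᵇ g v) λ gu≢gv → uv≁xy (only-xy uv gu≢gv)
    case : (f u ≢ f x) ⊎ (f v ≢ f x) → (g x ≢ g u) ⊎ (g y ≢ g u) → ⊥
    case (inj₁ fu≢) (inj₁ gx≢) = uv≁xy (separated fu≢ (gx≢ ∘ sym))
    case (inj₁ fu≢) (inj₂ gy≢) = uv≁xy (separated (fu≢ ∘ (λ eq → trans eq (sym fx≡fy))) (gy≢ ∘ sym))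
    case (inj₂ fv≢) (inj₁ gx≢) = uv≁xy (separated fv≢ (gx≢ ∘ (λ eq → trans (sym eq) (sym gu≡gv))))
    case (inj₂ fv≢) (inj₂ gy≢) = uv≁xy (separated (fv≢ ∘ (λ eq → trans eq (sym fx≡fy)))
      (gy≢ ∘ (λ eq → trans (sym eq) (sym gu≡gv))))

bridges⇒size-≤ : 3 ≤ n → {G : Graph n} → RainbowColourable 3 G c →
  (∀ u v → Adj G u v → IsBridge G u v) → size G ≤ c
bridges⇒size-≤ {c = c} 3≤n {G} (χ , rc) bridge with size G ℕ.≤? c
... | yes size≤c = size≤c
... | no size≰c with pigeonhole (ℕ.≰⇒> size≰c) (λ i → let u , v = lookup (edges G) i in colour χ u v)
... | i , j , i<j , same with ∈-edges⁻ G (∈-lookup i) | ∈-edges⁻ G (∈-lookup j)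
... | u<v , uv | x<y , xy with bridges-differ 3≤n χ rc uv (bridge _ _ uv) xy (bridge _ _ xy) same
... | inj₁ (u≡x , v≡y) =
  contradiction (lookup-injective (edges-Unique G) (cong₂ _,_ u≡x v≡y)) (Fin.<⇒≢ i<j)
-- Listed pairs have their smaller end first, so two of them cannot be reverses of each other.
... | inj₂ (u≡y , v≡x) = contradiction (subst₂ Fin._<_ u≡y v≡x u<v) (Fin.<-asym x<y)

-- Finite check for trees on three to five vertices

Cut : Graph n → Set
Cut {n} G = Σ[ A ∈ Subset n ] (∃₂ λ u v → Vec.lookup A u ≢ Vec.lookup A v) ×
  (∀ u v → Adj G u v → Vec.lookup A u ≡ Vec.lookup A v)

cut? : (G : Graph n) → Dec (Cut G)
cut? G = anySubset? λ A →
  (any? λ u → any? λ v → ¬? (Vec.lookup A u ≟ᵇ Vec.lookup A v)) ×-dec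
  (all? λ u → all? λ v → T? (adj G u v) →-dec (Vec.lookup A u ≟ᵇ Vec.lookup A v))

Connected⇒¬Cut : {G : Graph n} → Connected G → ¬ Cut G
Connected⇒¬Cut connected (A , (u , v , u≢v) , closed)
  with Star-exit (λ x → Vec.lookup A x ≟ᵇ Vec.lookup A u) (connected u v) refl (u≢v ∘ sym)
... | x , y , xy , x≡u , y≢u = y≢u (trans (sym (closed x y xy)) x≡u)

-- `IsBridge` with the side function stored as a subset, so that its existence is decidable by
-- enumeration.
SubsetBridge : Graph n → Fin n → Fin n → Set
SubsetBridge {n} G u v = Σ[ A ∈ Subset n ] Vec.lookup A u ≢ Vec.lookup A v ×
  (∀ p q → Adj G p q → Vec.lookup A p ≢ Vec.lookup A q → SameEdge p q u v)

subsetBridge? : (G : Graph n) → ∀ u v → Dec (SubsetBridge G u v)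
subsetBridge? G u v = anySubset? λ A → ¬? (Vec.lookup A u ≟ᵇ Vec.lookup A v) ×-dec
  (all? λ p → all? λ q → T? (adj G p q) →-dec ¬? (Vec.lookup A p ≟ᵇ Vec.lookup A q) →-dec
    sameEdge? p q u v)

-- Meant for m + 1 vertices, where a connected graph with m edges is a tree.
TreeBound : ℕ → Graph n → Set
TreeBound m G = (suc m ≤ size G) ⊎ Cut G ⊎ (m ≤ size G × (∀ u v → Adj G u v → SubsetBridge G u v))

treeBound? : ∀ m (G : Graph n) → Dec (TreeBound m G)
treeBound? m G = (suc m ℕ.≤? size G) ⊎-dec cut? G ⊎-dec
  ((m ℕ.≤? size G) ×-dec (all? λ u → all? λ v → T? (adj G u v) →-dec subsetBridge? G u v))

abstract
  -- A connected graph on `m + 1` vertices has at least `m` edges, and with exactly `m` it is a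
  -- tree, all of whose edges are bridges. For these orders the 8, 64 and 1024 adjacency matrices
  -- are simply inspected.
  treeBound₃ : ∀ M → TreeBound 2 (toGraph {3} M)
  treeBound₃ = from-yes (every? (search-Adjacency 3) (λ M → treeBound? 2 (toGraph M)))

  treeBound₄ : ∀ M → TreeBound 3 (toGraph {4} M)
  treeBound₄ = from-yes (every? (search-Adjacency 4) (λ M → treeBound? 3 (toGraph M)))

  treeBound₅ : ∀ M → TreeBound 4 (toGraph {5} M)
  treeBound₅ = from-yes (every? (search-Adjacency 5) (λ M → treeBound? 4 (toGraph M)))

-- Colourings with two colours

only-two-colours : {κ ν μ : Fin 2} → κ ≢ μ → ν ≢ μ → κ ≡ ν
only-two-colours {0F} {0F} _ _ = refl
only-two-colours {1F} {1F} _ _ = refl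
only-two-colours {0F} {1F} {0F} κ≢ _ = contradiction refl κ≢
only-two-colours {0F} {1F} {1F} _ λ≢ = contradiction refl λ≢
only-two-colours {1F} {0F} {0F} _ λ≢ = contradiction refl λ≢
only-two-colours {1F} {0F} {1F} κ≢ _ = contradiction refl κ≢

module TwoColours {n : ℕ} (3≤n : 3 ≤ n) {G : Graph n} (χ : EdgeColouring G 2)
  (rc : IsRainbowColouring 3 χ) where

  Coloured : Fin 2 → Fin n → Fin n → Set
  Coloured κ x y = Adj G x y × colour χ x y ≡ κ

  coloured? : ∀ κ x y → Dec (Coloured κ x y)
  coloured? κ x y = T? (adj G x y) ×-dec (colour χ x y ≟ κ)

  Coloured-sym : ∀ {κ x y} → Coloured κ x y → Coloured κ y x
  Coloured-sym (xy , eq) = Adj-sym G xy , trans (EdgeColouring.symm χ _ _) eq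

  Shows : Fin 2 → Fin n → Fin n → Fin n → Set
  Shows κ x y z = Coloured κ x y ⊎ Coloured κ x z ⊎ Coloured κ y z

  module _ (H : Subgraph G) (isTree : IsTree H) (rainbow : Rainbow χ H) where

    leave : ∀ {x y} → x ∈ V H → y ∈ V H → x ≢ y → ∃ λ x′ → Adj (E H) x x′
    leave {x} x∈ y∈ x≢y with Star-exit (_≟ x) (IsTree.connected isTree x∈ y∈) refl (x≢y ∘ sym)
    ... | _ , x′ , xx′ , refl , _ = x′ , xx′

    -- The tree has one edge of each colour, so z is joined to the edge xy.
    edge⇒shows : ∀ {x y z} → x ≢ z → y ≢ z → x ∈ V H → z ∈ V H → Adj (E H) x y → ∀ κ → Shows κ x y z
    edge⇒shows {x} {y} {z} x≢z y≢z x∈ z∈ xy κ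
      with Star-exit (λ a → (a ≟ x) ⊎-dec (a ≟ y)) (IsTree.connected isTree x∈ z∈) (inj₁ refl)
             [ x≢z ∘ sym , y≢z ∘ sym ]′
         | leave z∈ x∈ (x≢z ∘ sym)
    -- The edge `pq` leaves the pair `x`, `y`, and `zz′` starts outside it. Neither is the edge
    -- `xy`, so both have the other colour and coincide; hence `z` is joined to `x` or `y`.
    ... | p , q , pq , p∈xy , q∉xy | z′ , zz′ =
      answer (rainbow zz′ pq (only-two-colours zz′≢xy pq≢xy)) p∈xy
      where
      zz′≢xy : colour χ z z′ ≢ colour χ x y
      zz′≢xy eq with rainbow zz′ xy eq
      ... | inj₁ (z≡x , _) = x≢z (sym z≡x)
      ... | inj₂ (z≡y , _) = y≢z (sym z≡y)
      pq≢xy : colour χ p q ≢ colour χ x y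
      pq≢xy eq with rainbow pq xy eq
      ... | inj₁ (_ , q≡y) = q∉xy (inj₂ q≡y)
      ... | inj₂ (_ , q≡x) = q∉xy (inj₁ q≡x)
      pick : Coloured (colour χ p q) x z ⊎ Coloured (colour χ p q) y z → Shows κ x y z
      pick third with κ ≟ colour χ x y
      ... | yes refl = inj₁ (Subgraph.E⊆G H xy , refl)
      ... | no κ≢xy with refl ← only-two-colours κ≢xy pq≢xy = inj₂ third
      answer : SameEdge z z′ p q → p ≡ x ⊎ p ≡ y → Shows κ x y z
      answer (inj₁ (z≡p , _)) (inj₁ p≡x) = contradiction (sym (trans z≡p p≡x)) x≢z
      answer (inj₁ (z≡p , _)) (inj₂ p≡y) = contradiction (sym (trans z≡p p≡y)) y≢z
      answer (inj₂ (refl , _)) (inj₁ refl) = pick (inj₁ (Subgraph.E⊆G H pq , refl))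
      answer (inj₂ (refl , _)) (inj₂ refl) = pick (inj₂ (Subgraph.E⊆G H pq , refl))

  -- Choose a tree edge at each of the three vertices. Two of these edges share a colour, hence
  -- coincide, and the common edge joins two of the three vertices; `edge⇒shows` then attaches the
  -- third.
  shows : ∀ {x y z} → x ≢ y → x ≢ z → y ≢ z → ∀ κ → Shows κ x y z
  shows {x} {y} {z} x≢y x≢z y≢z κ
    with leave H isTree rainbow x∈ y∈ x≢y | leave H isTree rainbow y∈ x∈ (x≢y ∘ sym)
       | leave H isTree rainbow z∈ x∈ (x≢z ∘ sym)
    where open RainbowTreeThrough (treeThrough 3≤n χ rc x y z)
  ... | x′ , xx′ | y′ , yy′ | z′ , zz′ = split (colour χ x x′ ≟ colour χ y y′) (colour χ x x′ ≟ colour χ z z′)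
    where
    open RainbowTreeThrough (treeThrough 3≤n χ rc x y z)
    meet : ∀ {a a′ b b′} → Adj (E H) a a′ → Adj (E H) b b′ → a ≢ b → colour χ a a′ ≡ colour χ b b′ →
      Adj (E H) a b
    meet aa′ bb′ a≢b eq with rainbow aa′ bb′ eq
    ... | inj₁ (a≡b , _) = contradiction a≡b a≢b
    ... | inj₂ (_ , refl) = aa′
    split : Dec (colour χ x x′ ≡ colour χ y y′) → Dec (colour χ x x′ ≡ colour χ z z′) → Shows κ x y z
    split (yes x~y) _ = edge⇒shows H isTree rainbow x≢z y≢z x∈ z∈ (meet xx′ yy′ x≢y x~y) κ
    split (no _) (yes x~z)
      with edge⇒shows H isTree rainbow x≢y (y≢z ∘ sym) x∈ y∈ (meet xx′ zz′ x≢z x~z) κ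
    ... | inj₁ xz        = inj₂ (inj₁ xz)
    ... | inj₂ (inj₁ xy) = inj₁ xy
    ... | inj₂ (inj₂ zy) = inj₂ (inj₂ (Coloured-sym zy))
    split (no x≁y) (no x≁z)
      with edge⇒shows H isTree rainbow (x≢y ∘ sym) (x≢z ∘ sym) y∈ x∈
        (meet yy′ zz′ y≢z (only-two-colours (x≁y ∘ sym) (x≁z ∘ sym))) κ
    ... | inj₁ yz        = inj₂ (inj₂ yz)
    ... | inj₂ (inj₁ yx) = inj₁ (Coloured-sym yx)
    ... | inj₂ (inj₂ zx) = inj₂ (inj₁ (Coloured-sym zx))

  -- A non-edge counts as not red, so all pairs are coloured and Ramsey's argument applies even
  -- before anything is known about adjacency.
  red : Fin n → Fin n → Bool
  red x y = does (coloured? 0F x y)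

  no-mono-triangle : ∀ {x y z} → x ≢ y → x ≢ z → y ≢ z → ∀ β →
    red x y ≡ β → red x z ≡ β → red y z ≡ β → ⊥
  no-mono-triangle {x} {y} {z} x≢y x≢z y≢z true xy xz yz =
    [ not-both xy , [ not-both xz , not-both yz ]′ ]′ (shows x≢y x≢z y≢z 1F)
    where
    not-both : ∀ {a b} → red a b ≡ true → ¬ Coloured 1F a b
    not-both {a} {b} ab (_ , is-1) with () ← trans (sym is-1) (proj₂ (T-does⁻ (coloured? 0F a b) (subst T (sym ab) _)))
  no-mono-triangle {x} {y} {z} x≢y x≢z y≢z false xy xz yz =
    [ not-both xy , [ not-both xz , not-both yz ]′ ]′ (shows x≢y x≢z y≢z 0F)
    where
    not-both : ∀ {a b} → red a b ≡ false → ¬ Coloured 0F a b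
    not-both {a} {b} ab is-0 = subst T ab (T-does⁺ (coloured? 0F a b) is-0)

  -- Edges of different colours are different edges. What remains is a condition on the graph alone,
  -- which a search over adjacency matrices can use.
  two-edges : ∀ {x y z} → x ≢ y → x ≢ z → y ≢ z →
    (Adj G x y × Adj G x z) ⊎ (Adj G x y × Adj G y z) ⊎ (Adj G x z × Adj G y z)
  two-edges x≢y x≢z y≢z with shows x≢y x≢z y≢z 0F | shows x≢y x≢z y≢z 1F
  ... | inj₁ (xy , _)        | inj₂ (inj₁ (xz , _)) = inj₁ (xy , xz)
  ... | inj₁ (xy , _)        | inj₂ (inj₂ (yz , _)) = inj₂ (inj₁ (xy , yz))
  ... | inj₂ (inj₁ (xz , _)) | inj₁ (xy , _)        = inj₁ (xy , xz)
  ... | inj₂ (inj₁ (xz , _)) | inj₂ (inj₂ (yz , _)) = inj₂ (inj₂ (xz , yz))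
  ... | inj₂ (inj₂ (yz , _)) | inj₁ (xy , _)        = inj₂ (inj₁ (xy , yz))
  ... | inj₂ (inj₂ (yz , _)) | inj₂ (inj₁ (xz , _)) = inj₂ (inj₂ (xz , yz))
  ... | inj₁ (_ , p)         | inj₁ (_ , q)         with () ← trans (sym p) q
  ... | inj₂ (inj₁ (_ , p))  | inj₂ (inj₁ (_ , q))  with () ← trans (sym p) q
  ... | inj₂ (inj₂ (_ , p))  | inj₂ (inj₂ (_ , q))  with () ← trans (sym p) q

abstract
  three-equal-of-five : ∀ (v : Vec Bool 5) → ∃ λ i → ∃₂ λ j k → i Fin.< j × j Fin.< k ×
    Vec.lookup v i ≡ Vec.lookup v j × Vec.lookup v i ≡ Vec.lookup v k
  three-equal-of-five = from-yes (every? (search-Vec search-Bool 5) λ v →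
    any? λ i → any? λ j → any? λ k → (i <? j) ×-dec (j <? k) ×-dec
      (Vec.lookup v i ≟ᵇ Vec.lookup v j) ×-dec (Vec.lookup v i ≟ᵇ Vec.lookup v k))

-- The Ramsey bound R(3,3) ≤ 6.
no-two-colouring : 6 ≤ n → {G : Graph n} → ¬ RainbowColourable 3 G 2
no-two-colouring {n} 6≤n {G} (χ , rc) = triangle (three-equal-of-five (Vec.tabulate star))
  where
  open TwoColours (ℕ.≤-trans (s≤s (s≤s (s≤s z≤n))) 6≤n) χ rc
  v : Fin 6 → Fin n
  v i = inject≤ i 6≤n
  star : Fin 5 → Bool
  star i = red (v 0F) (v (suc i))
  v-injective : ∀ {a b} → v a ≡ v b → a ≡ b
  v-injective = inject≤-injective 6≤n 6≤n _ _
  ≢v : ∀ {a b : Fin 5} → a Fin.< b → v (suc a) ≢ v (suc b)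
  ≢v a<b eq = Fin.<⇒≢ a<b (suc-injective (v-injective eq))
  opposite : ∀ {a b} β → a Fin.< b → star a ≡ β → star b ≡ β → red (v (suc a)) (v (suc b)) ≡ not β
  opposite β a<b a∼β b∼β = ¬-not λ eq → no-mono-triangle
    (λ e → Fin.0≢1+n (v-injective e)) (λ e → Fin.0≢1+n (v-injective e)) (≢v a<b) β a∼β b∼β eq
  triangle : (∃ λ i → ∃₂ λ j k → i Fin.< j × j Fin.< k ×
    Vec.lookup (Vec.tabulate star) i ≡ Vec.lookup (Vec.tabulate star) j ×
    Vec.lookup (Vec.tabulate star) i ≡ Vec.lookup (Vec.tabulate star) k) → ⊥
  triangle (i , j , k , i<j , j<k , ij , ik) =
    no-mono-triangle (≢v i<j) (≢v (Fin.<-trans i<j j<k)) (≢v j<k) (not (star i))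
      (opposite (star i) i<j refl (at ij)) (opposite (star i) (Fin.<-trans i<j j<k) refl (at ik))
      (opposite (star i) j<k (at ij) (at ik))
    where
    at : ∀ {l} → Vec.lookup (Vec.tabulate star) i ≡ Vec.lookup (Vec.tabulate star) l → star l ≡ star i
    at {l} eq = trans (sym (lookup∘tabulate star l)) (trans (sym eq) (lookup∘tabulate star i))

-- If `uv` is missing, both colours of the triple `u`, `v`, `w i` must come from `u w i` and
-- `v w i`, so these differ. Two of the three vertices `w i` and `w j` agree in their colour towards
-- `u`, hence also in the opposite colour towards `v`. The triple with `u` now forces the colour of
-- `v w i` on the edge `w i w j`, and the triple with `v` forces the colour of `u w i` on it.
complete-if-two-coloured : {G : Graph 5} → RainbowColourable 3 G 2 → ∀ {u v} → u ≢ v → Adj G u v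
complete-if-two-coloured {G} (χ , rc) {u} {v} u≢v = decidable-stable (T? (adj G u v)) impossible
  where
  open TwoColours (s≤s (s≤s (s≤s z≤n))) χ rc

  w : Fin 3 → Fin 5
  -- The inner `punchIn` skips the index that `v` has once `u` is removed, so `w` lists the three
  -- other vertices.
  w i = punchIn u (punchIn (punchOut u≢v) i)
  u≢w : ∀ i → u ≢ w i
  u≢w i = punchInᵢ≢i u _ ∘ sym
  v≢w : ∀ i → v ≢ w i
  v≢w i eq = punchInᵢ≢i (punchOut u≢v) i
    (punchIn-injective u _ _ (trans (sym eq) (sym (punchIn-punchOut u≢v))))
  w-injective : ∀ {i j} → w i ≡ w j → i ≡ j
  w-injective eq = punchIn-injective (punchOut u≢v) _ _ (punchIn-injective u _ _ eq)

  impossible : ¬ ¬ Adj G u v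
  impossible ¬uv with pigeonhole (s≤s (s≤s (s≤s z≤n))) (λ i → colour χ u (w i))
  ... | i , j , i<j , same = clash (shows (u≢w i) (u≢w j) wi≢wj (colour χ v (w i)))
    (shows (v≢w i) (v≢w j) wi≢wj (colour χ u (w i)))
    where
    wi≢wj : w i ≢ w j
    wi≢wj eq = Fin.<⇒≢ i<j (w-injective eq)
    differ : ∀ i → colour χ u (w i) ≢ colour χ v (w i)
    differ i eq with shows u≢v (u≢w i) (v≢w i) 0F | shows u≢v (u≢w i) (v≢w i) 1F
    ... | inj₁ (uv , _)       | _                   = ¬uv uv
    ... | _                   | inj₁ (uv , _)       = ¬uv uv
    ... | inj₂ (inj₁ (_ , p)) | inj₂ (inj₁ (_ , q)) with () ← trans (sym p) q
    ... | inj₂ (inj₂ (_ , p)) | inj₂ (inj₂ (_ , q)) with () ← trans (sym p) q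
    ... | inj₂ (inj₁ (_ , p)) | inj₂ (inj₂ (_ , q)) with () ← trans (sym p) (trans eq q)
    ... | inj₂ (inj₂ (_ , p)) | inj₂ (inj₁ (_ , q)) with () ← trans (sym p) (trans (sym eq) q)
    same-v : colour χ v (w i) ≡ colour χ v (w j)
    same-v = only-two-colours (differ i ∘ sym) (λ eq → differ j (trans (sym same) (sym eq)))
    clash : Shows (colour χ v (w i)) u (w i) (w j) → Shows (colour χ u (w i)) v (w i) (w j) → ⊥
    clash (inj₁ (_ , eq))        _                       = differ i eq
    clash (inj₂ (inj₁ (_ , eq))) _                       = differ i (trans same eq)
    clash (inj₂ (inj₂ _))        (inj₁ (_ , eq))         = differ i (sym eq)
    clash (inj₂ (inj₂ _))        (inj₂ (inj₁ (_ , eq)))  = differ i (sym (trans same-v eq))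
    clash (inj₂ (inj₂ (_ , p)))  (inj₂ (inj₂ (_ , q)))   = differ i (trans (sym q) p)

TwoEdgesPerTriple : Graph n → Set
TwoEdgesPerTriple G = ∀ x y z → x ≢ y → x ≢ z → y ≢ z →
  (Adj G x y × Adj G x z) ⊎ (Adj G x y × Adj G y z) ⊎ (Adj G x z × Adj G y z)

twoEdgesPerTriple? : (G : Graph n) → Dec (TwoEdgesPerTriple G)
twoEdgesPerTriple? G = all? λ x → all? λ y → all? λ z →
  ¬? (x ≟ y) →-dec ¬? (x ≟ z) →-dec ¬? (y ≟ z) →-dec
  ((T? (adj G x y) ×-dec T? (adj G x z)) ⊎-dec (T? (adj G x y) ×-dec T? (adj G y z)) ⊎-dec
  (T? (adj G x z) ×-dec T? (adj G y z)))

abstract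
  -- No triple contains two non-edges, so the non-edges form a matching: at most two of the six
  -- pairs are missing.
  twoEdgesPerTriple₄ : ∀ M → TwoEdgesPerTriple (toGraph {4} M) → 4 ≤ size (toGraph M)
  twoEdgesPerTriple₄ = from-yes (every? (search-Adjacency 4) λ M →
    twoEdgesPerTriple? (toGraph M) →-dec (4 ℕ.≤? size (toGraph M)))

-- Explicit colourings of orders three to five

-- Entry "just κ" is an edge of colour κ, entry "nothing" a non-edge.
Picture : ℕ → ℕ → Set
Picture c = SymMatrix ⊤ (Maybe (Fin (suc c)))

picturedGraph : Picture c n → Graph n
picturedGraph P = record
  { adj    = λ u v → is-just (entry (const nothing) P u v)
  ; symm   = λ u v → cong is-just (entry-symm (const nothing) P u v)
  ; irrefl = loopless P
  }
  where
  loopless : (P : Picture c n) → ∀ u → is-just (entry (const nothing) P u u) ≡ false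
  loopless P           zero    = refl
  loopless (_ , _ , P) (suc u) = loopless P u

picturedColouring : (P : Picture c n) → EdgeColouring (picturedGraph P) (suc c)
picturedColouring P = record
  -- The default `0F` is the filler on non-edges; it exists because the palette has `suc c` colours.
  { colour = λ u v → fromMaybe 0F (entry (const nothing) P u v)
  ; symm   = λ u v → cong (fromMaybe 0F) (entry-symm (const nothing) P u v)
  }

pattern c₁ = just 0F
pattern c₂ = just 1F
pattern c₃ = just 2F
pattern ∙ = nothing

-- Each `tt` is a diagonal entry; the vector after it holds the entries towards the later vertices.
path₃ : Picture 1 3
path₃ = tt , c₁ ∷ ∙ ∷ [] , tt , c₂ ∷ [] , tt , [] , tt

cycle₄ : Picture 1 4
cycle₄ = tt , c₁ ∷ ∙ ∷ c₂ ∷ [] , tt , c₂ ∷ ∙ ∷ [] , tt , c₁ ∷ [] , tt , [] , tt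

star₄ : Picture 2 4
star₄ = tt , c₁ ∷ c₂ ∷ c₃ ∷ [] , tt , ∙ ∷ ∙ ∷ [] , tt , ∙ ∷ [] , tt , [] , tt

-- Around the cycle the colours read 1, 2, 1, 2, 3. Three consecutive edges that include the one of
-- colour 3 are rainbow. A triple of non-consecutive vertices lies on two three-edge paths that
-- together use all five edges, so one of them is rainbow; for consecutive vertices two adjacent
-- edges suffice.
cycle₅ : Picture 2 5
cycle₅ = tt , c₁ ∷ ∙ ∷ ∙ ∷ c₃ ∷ [] , tt , c₂ ∷ ∙ ∷ ∙ ∷ [] , tt , c₁ ∷ ∙ ∷ [] , tt , c₂ ∷ [] , tt , [] , tt

-- A pentagon and its complementary pentagram.
complete₅ : Picture 1 5
complete₅ = tt , c₁ ∷ c₂ ∷ c₂ ∷ c₁ ∷ [] , tt , c₁ ∷ c₂ ∷ c₂ ∷ [] , tt , c₁ ∷ c₂ ∷ [] , tt , c₁ ∷ [] , tt , [] , tt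

abstract
  path₃-rainbow : IsRainbowColouring 3 (picturedColouring path₃)
  path₃-rainbow = from-yes (isRainbowColouring? (picturedColouring path₃) 3)

  cycle₄-rainbow : IsRainbowColouring 3 (picturedColouring cycle₄)
  cycle₄-rainbow = from-yes (isRainbowColouring? (picturedColouring cycle₄) 3)

  star₄-rainbow : IsRainbowColouring 3 (picturedColouring star₄)
  star₄-rainbow = from-yes (isRainbowColouring? (picturedColouring star₄) 3)

  cycle₅-rainbow : IsRainbowColouring 3 (picturedColouring cycle₅)
  cycle₅-rainbow = from-yes (isRainbowColouring? (picturedColouring cycle₅) 3)

  complete₅-rainbow : IsRainbowColouring 3 (picturedColouring complete₅)
  complete₅-rainbow = from-yes (isRainbowColouring? (picturedColouring complete₅) 3)

-- The colouring by order of indices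

members : Subset n → List (Fin n)
members []            = []
members (inside ∷ S)  = zero ∷ map suc (members S)
members (outside ∷ S) = map suc (members S)

length-members : (S : Subset n) → length (members S) ≡ ∣ S ∣
length-members []            = refl
length-members (inside ∷ S)  = cong suc (trans (length-map suc (members S)) (length-members S))
length-members (outside ∷ S) = trans (length-map suc (members S)) (length-members S)

∈-members : {S : Subset n} → ∀ {x} → x ∈ S → x ∈ˡ members S
∈-members {S = inside ∷ S}  here        = here refl
∈-members {S = inside ∷ S}  (there x∈S) = there (∈-map⁺ suc (∈-members x∈S))
∈-members {S = outside ∷ S} (there x∈S) = ∈-map⁺ suc (∈-members x∈S)

members-sorted : (S : Subset n) → AllPairs Fin._<_ (members S)
members-sorted []            = []
members-sorted (inside ∷ S)  = All.map⁺ (All.universal (λ _ → z<s) (members S)) ∷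
  AllPairs.map⁺ (AllPairs.map s<s (members-sorted S))
members-sorted (outside ∷ S) = AllPairs.map⁺ (AllPairs.map s<s (members-sorted S))

SpannedBy : {G : Graph n} → EdgeColouring G c → List (Fin n) → Set
SpannedBy χ vs = ∃₂ λ ws cs → RainbowGrowth χ ws cs × All (_∈ˡ ws) vs

-- Listing a triple in increasing order leaves only the label patterns compatible with `_≺_`, and
-- makes the indices inside each class comparable.
sorted-triples-suffice : {G : Graph n} (χ : EdgeColouring G c) →
  (∀ {u v w} → u Fin.< v → v Fin.< w → SpannedBy χ (u ∷ v ∷ w ∷ [])) → IsRainbowColouring 3 χ
sorted-triples-suffice χ spanned S ∣S∣≡3 =
  go (members S) (trans (length-members S) ∣S∣≡3) (members-sorted S) ∈-members
  where
  go : ∀ vs → length vs ≡ 3 → AllPairs Fin._<_ vs → (∀ {x} → x ∈ S → x ∈ˡ vs) → RainbowTree χ S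
  go (u ∷ v ∷ w ∷ []) _ ((u<v ∷ _) ∷ (v<w ∷ _) ∷ _) S⊆vs with spanned u<v v<w
  ... | ws , cs , growth , vs⊆ws =
    RainbowGrowth⇒RainbowTree χ growth λ x∈S → All.lookup vs⊆ws (S⊆vs x∈S)

order : ∀ {m} → Fin m → Fin m → Fin 3
order i j with <-cmp i j
... | tri≈ _ _ _ = 0F
... | tri< _ _ _ = 1F
... | tri> _ _ _ = 2F

order-≡ : ∀ {m} (i : Fin m) → order i i ≡ 0F
order-≡ i with <-cmp i i
... | tri≈ _ _ _   = refl
... | tri< i<i _ _ = contradiction i<i (<-irrefl refl)
... | tri> _ _ i<i = contradiction i<i (<-irrefl refl)

order-< : ∀ {m} {i j : Fin m} → i Fin.< j → order i j ≡ 1F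
order-< {i = i} {j} i<j with <-cmp i j
... | tri< _ _ _     = refl
... | tri≈ i≮j _ _   = contradiction i<j i≮j
... | tri> i≮j _ _   = contradiction i<j i≮j

order-> : ∀ {m} {i j : Fin m} → j Fin.< i → order i j ≡ 2F
order-> {i = i} {j} j<i with <-cmp i j
... | tri> _ _ _     = refl
... | tri≈ _ _ j≮i   = contradiction j<i j≮i
... | tri< _ _ j≮i   = contradiction j<i j≮i

data Label (m : ℕ) : Set where
  W   : Label m
  X Y : Fin m → Label m

joined : ∀ {m} → Label m → Label m → Bool
joined (X _) (Y _) = true
joined (Y _) (X _) = true
joined W     (X _) = true
joined W     (Y _) = true
joined (X _) W     = true
joined (Y _) W     = true
joined W     W     = false
joined (X _) (X _) = false
joined (Y _) (Y _) = false

-- The vertex `W` acts at once as an `X` and a `Y` of infinite index: an `X i` sees it as a larger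
-- `Y`, colour `1F`, and a `Y j` sees it as a larger `X`, colour `2F`. The values on pairs that are
-- not joined are fillers.
hue : ∀ {m} → Label m → Label m → Fin 3
hue (X i) (Y j) = order i j
hue (Y j) (X i) = order i j
hue W     (X _) = 1F
hue (X _) W     = 1F
hue W     (Y _) = 2F
hue (Y _) W     = 2F
hue W     W     = 0F
hue (X _) (X _) = 0F
hue (Y _) (Y _) = 0F

joined-symm : ∀ {m} (p q : Label m) → joined p q ≡ joined q p
joined-symm W     W     = refl
joined-symm W     (X _) = refl
joined-symm W     (Y _) = refl
joined-symm (X _) W     = refl
joined-symm (X _) (X _) = refl
joined-symm (X _) (Y _) = refl
joined-symm (Y _) W     = refl
joined-symm (Y _) (X _) = refl
joined-symm (Y _) (Y _) = refl

joined-irrefl : ∀ {m} (p : Label m) → joined p p ≡ false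
joined-irrefl W     = refl
joined-irrefl (X _) = refl
joined-irrefl (Y _) = refl

hue-symm : ∀ {m} (p q : Label m) → hue p q ≡ hue q p
hue-symm W     W     = refl
hue-symm W     (X _) = refl
hue-symm W     (Y _) = refl
hue-symm (X _) W     = refl
hue-symm (X _) (X _) = refl
hue-symm (X _) (Y _) = refl
hue-symm (Y _) W     = refl
hue-symm (Y _) (X _) = refl
hue-symm (Y _) (Y _) = refl

data _≺_ {m : ℕ} : Label m → Label m → Set where
  W≺X : ∀ {i} → W ≺ X i
  W≺Y : ∀ {i} → W ≺ Y i
  X≺X : ∀ {i j} → i Fin.< j → X i ≺ X j
  X≺Y : ∀ {i j} → X i ≺ Y j
  Y≺Y : ∀ {i j} → i Fin.< j → Y i ≺ Y j

-- Common ground of the even and the odd case: `W` may or may not occur as a label, and the case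
-- analysis on sorted triples is made only once.
record Labelling (n m : ℕ) : Set where
  field
    label   : Fin n → Label m
    x y     : Fin m → Fin n
    label-x : ∀ i → label (x i) ≡ X i
    label-y : ∀ i → label (y i) ≡ Y i
    ordered : ∀ {u v} → u Fin.< v → label u ≺ label v

  graph : Graph n
  graph = record
    { adj    = λ u v → joined (label u) (label v)
    ; symm   = λ u v → joined-symm (label u) (label v)
    ; irrefl = λ u → joined-irrefl (label u)
    }

  χ : EdgeColouring graph 3
  χ = record
    { colour = λ u v → hue (label u) (label v)
    ; symm   = λ u v → hue-symm (label u) (label v)
    }

  infix 4 _—[_]—_

  _—[_]—_ : Fin n → Fin 3 → Fin n → Set
  u —[ κ ]— v = Adj graph u v × colour χ u v ≡ κ

  edge : ∀ {u v p q} κ → label u ≡ p → label v ≡ q → T (joined p q) → hue p q ≡ κ → u —[ κ ]— v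
  edge κ refl refl uv eq = uv , eq

  flip-edge : ∀ {u v κ} → u —[ κ ]— v → v —[ κ ]— u
  flip-edge {u} {v} (uv , eq) =
    Adj-sym graph {u} {v} uv , trans (hue-symm (label v) (label u)) eq

  far-ends : ∀ {t u v κ μ} → t —[ κ ]— u → t —[ μ ]— v → κ ≢ μ → u ≢ v
  far-ends (_ , refl) (_ , refl) κ≢μ refl = κ≢μ refl

  ends : ∀ {u v κ} → u —[ κ ]— v → u ≢ v
  ends {u} (uv , _) = Adj⇒≢ graph uv

  ∉₁ : ∀ {A : Set} {a b : A} → a ≢ b → a ∉ˡ [ b ]
  ∉₁ a≢b (here a≡b) = a≢b a≡b

  ∉₂ : ∀ {A : Set} {a b : A} {bs} → a ≢ b → a ∉ˡ bs → a ∉ˡ b ∷ bs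
  ∉₂ a≢b a∉bs (here a≡b)   = a≢b a≡b
  ∉₂ a≢b a∉bs (there a∈bs) = a∉bs a∈bs

  hues : ∀ {t u v w κ μ} → t —[ κ ]— u → v —[ μ ]— w → κ ≢ μ → colour χ t u ≢ colour χ v w
  hues (_ , refl) (_ , refl) κ≢μ = κ≢μ

  growth₂ : ∀ {t u v κ μ} → t —[ κ ]— u → u —[ μ ]— v → κ ≢ μ →
    ∃ (RainbowGrowth χ (v ∷ u ∷ t ∷ []))
  growth₂ {t} tu uv κ≢μ = _ , grow (grow (root t) (here refl) (∉₁ (ends tu ∘ sym)) (proj₁ tu) λ ())
    (here refl) (∉₂ (ends uv ∘ sym) (∉₁ (far-ends (flip-edge tu) uv κ≢μ ∘ sym))) (proj₁ uv)
    (∉₁ (hues uv tu (κ≢μ ∘ sym)))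

  -- Differently coloured edges at a common vertex have different far ends, which gives most of the
  -- distinctness. Only the two ends of the path must be kept apart by hypothesis, since three edges
  -- of distinct colours could close up to a triangle.
  growth-path : ∀ {t u v w κ μ ν} → t —[ κ ]— u → u —[ μ ]— v → v —[ ν ]— w → κ ≢ μ → κ ≢ ν → μ ≢ ν →
    t ≢ w → ∃ (RainbowGrowth χ (w ∷ v ∷ u ∷ t ∷ []))
  growth-path tu uv vw κ≢μ κ≢ν μ≢ν t≢w = _ , grow (proj₂ (growth₂ tu uv κ≢μ)) (here refl)
    (∉₂ (ends vw ∘ sym) (∉₂ (far-ends (flip-edge uv) vw μ≢ν ∘ sym) (∉₁ (t≢w ∘ sym)))) (proj₁ vw)
    (∉₂ (hues vw uv (μ≢ν ∘ sym)) (∉₁ (hues vw tu (κ≢ν ∘ sym))))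

  growth-star : ∀ {t u v w κ μ ν} → t —[ κ ]— u → t —[ μ ]— v → t —[ ν ]— w → κ ≢ μ → κ ≢ ν → μ ≢ ν →
    ∃ (RainbowGrowth χ (w ∷ v ∷ t ∷ u ∷ []))
  growth-star tu tv tw κ≢μ κ≢ν μ≢ν = _ , grow (proj₂ (growth₂ (flip-edge tu) tv κ≢μ)) (there (here refl))
    (∉₂ (far-ends tv tw μ≢ν ∘ sym) (∉₂ (ends tw ∘ sym) (∉₁ (far-ends tu tw κ≢ν ∘ sym)))) (proj₁ tw)
    (∉₂ (hues tw tv (μ≢ν ∘ sym)) (∉₁ (hues tw (flip-edge tu) (κ≢ν ∘ sym))))

  cherry : ∀ {t u v κ μ} → t —[ κ ]— u → t —[ μ ]— v → κ ≢ μ → ∃ (RainbowGrowth χ (v ∷ t ∷ u ∷ []))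
  cherry tu tv = growth₂ (flip-edge tu) tv

  -- For three indices `i < j < k` in one class, the vertex of index `j` in the other class sees all
  -- three colours. In a mixed triple the vertex that is alone in its class often sees the other two
  -- in different colours, and these two edges suffice. If it sees the same colour twice, its index
  -- is beyond both on one side, and one of the two edges is replaced by a detour through an edge of
  -- colour `0F`, between equal indices. Triples of `W` with two vertices of one class use the same
  -- detour.
  spanned : ∀ {u v w p q r} → label u ≡ p → label v ≡ q → label w ≡ r → p ≺ q → q ≺ r →
    SpannedBy χ (u ∷ v ∷ w ∷ [])
  spanned {u} {v} {w} {X i} {X j} {X k} pu pv pw (X≺X i<j) (X≺X j<k)
    with growth-star (edge 1F (label-y j) pu tt (order-< i<j)) (edge 0F (label-y j) pv tt (order-≡ j))
           (edge 2F (label-y j) pw tt (order-> j<k)) (λ ()) (λ ()) (λ ())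
  ... | cs , growth = _ , cs , growth ,
    there (there (there (here refl))) ∷ there (here refl) ∷ here refl ∷ []
  spanned {u} {v} {w} {Y i} {Y j} {Y k} pu pv pw (Y≺Y i<j) (Y≺Y j<k)
    with growth-star (edge 2F (label-x j) pu tt (order-> i<j)) (edge 0F (label-x j) pv tt (order-≡ j))
           (edge 1F (label-x j) pw tt (order-< j<k)) (λ ()) (λ ()) (λ ())
  ... | cs , growth = _ , cs , growth ,
    there (there (there (here refl))) ∷ there (here refl) ∷ here refl ∷ []
  spanned {u} {v} {w} {W} {X i} {X j} pu pv pw W≺X (X≺X i<j)
    with growth-path (edge 1F pu pv tt refl) (edge 0F pv (label-y i) tt (order-≡ i))
           (edge 2F (label-y i) pw tt (order-> i<j)) (λ ()) (λ ()) (λ ()) (ends (edge 1F pu pw tt refl))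
  ... | cs , growth = _ , cs , growth ,
    there (there (there (here refl))) ∷ there (there (here refl)) ∷ here refl ∷ []
  spanned {u} {v} {w} {W} {Y i} {Y j} pu pv pw W≺Y (Y≺Y i<j)
    with growth-path (edge 2F pu pv tt refl) (edge 0F pv (label-x i) tt (order-≡ i))
           (edge 1F (label-x i) pw tt (order-< i<j)) (λ ()) (λ ()) (λ ()) (ends (edge 2F pu pw tt refl))
  ... | cs , growth = _ , cs , growth ,
    there (there (there (here refl))) ∷ there (there (here refl)) ∷ here refl ∷ []
  spanned {u} {v} {w} {W} {X i} {Y j} pu pv pw W≺X X≺Y
    with cherry (edge 1F pu pv tt refl) (edge 2F pu pw tt refl) (λ ())
  ... | cs , growth = _ , cs , growth ,
    there (here refl) ∷ there (there (here refl)) ∷ here refl ∷ []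
  spanned {u} {v} {w} {X i} {X j} {Y l} pu pv pw (X≺X i<j) X≺Y = cases (<-cmp i l) (<-cmp l j)
    where
    short : ∀ κ μ → order i l ≡ κ → order j l ≡ μ → κ ≢ μ → SpannedBy χ (u ∷ v ∷ w ∷ [])
    short κ μ il jl κ≢μ with cherry (edge κ pw pu tt il) (edge μ pw pv tt jl) κ≢μ
    ... | cs , growth = _ , cs , growth ,
      there (there (here refl)) ∷ here refl ∷ there (here refl) ∷ []
    cases : Tri (i Fin.< l) (i ≡ l) (l Fin.< i) → Tri (l Fin.< j) (l ≡ j) (j Fin.< l) →
      SpannedBy χ (u ∷ v ∷ w ∷ [])
    cases (tri< i<l _ _) (tri< l<j _ _) = short 1F 2F (order-< i<l) (order-> l<j) λ ()
    cases (tri< i<l _ _) (tri≈ _ refl _) = short 1F 0F (order-< i<l) (order-≡ l) λ ()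
    cases (tri≈ _ refl _) _ = short 0F 2F (order-≡ i) (order-> i<j) λ ()
    -- Both edges at `w` have colour `1F`, so `v` is reached through `u` and the vertex `y i`.
    cases (tri< i<l _ _) (tri> _ _ j<l)
      with growth-path (edge 1F pw pu tt (order-< i<l)) (edge 0F pu (label-y i) tt (order-≡ i))
             (edge 2F (label-y i) pv tt (order-> i<j)) (λ ()) (λ ()) (λ ())
             (ends (edge 1F pw pv tt (order-< j<l)))
    ... | cs , growth = _ , cs , growth ,
      there (there (here refl)) ∷ here refl ∷ there (there (there (here refl))) ∷ []
    cases (tri> _ _ l<i) _
      with growth-path (edge 2F pw pv tt (order-> (<-trans l<i i<j))) (edge 0F pv (label-y j) tt (order-≡ j))
             (edge 1F (label-y j) pu tt (order-< i<j)) (λ ()) (λ ()) (λ ())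
             (ends (edge 2F pw pu tt (order-> l<i)))
    ... | cs , growth = _ , cs , growth ,
      here refl ∷ there (there (here refl)) ∷ there (there (there (here refl))) ∷ []
  spanned {u} {v} {w} {X i} {Y j} {Y k} pu pv pw X≺Y (Y≺Y j<k) = cases (<-cmp i j) (<-cmp i k)
    where
    short : ∀ κ μ → order i j ≡ κ → order i k ≡ μ → κ ≢ μ → SpannedBy χ (u ∷ v ∷ w ∷ [])
    short κ μ ij ik κ≢μ with cherry (edge κ pu pv tt ij) (edge μ pu pw tt ik) κ≢μ
    ... | cs , growth = _ , cs , growth ,
      there (here refl) ∷ there (there (here refl)) ∷ here refl ∷ []
    cases : Tri (i Fin.< j) (i ≡ j) (j Fin.< i) → Tri (i Fin.< k) (i ≡ k) (k Fin.< i) →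
      SpannedBy χ (u ∷ v ∷ w ∷ [])
    cases (tri> _ _ j<i) (tri< i<k _ _) = short 2F 1F (order-> j<i) (order-< i<k) λ ()
    cases (tri> _ _ j<i) (tri≈ _ refl _) = short 2F 0F (order-> j<i) (order-≡ i) λ ()
    cases (tri≈ _ refl _) _ = short 0F 1F (order-≡ i) (order-< j<k) λ ()
    cases (tri< i<j _ _) _
      with growth-path (edge 1F pu pw tt (order-< (<-trans i<j j<k))) (edge 0F pw (label-x k) tt (order-≡ k))
             (edge 2F (label-x k) pv tt (order-> j<k)) (λ ()) (λ ()) (λ ())
             (ends (edge 1F pu pv tt (order-< i<j)))
    ... | cs , growth = _ , cs , growth ,
      there (there (there (here refl))) ∷ here refl ∷ there (there (here refl)) ∷ []
    cases (tri> _ _ j<i) (tri> _ _ k<i)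
      with growth-path (edge 2F pu pv tt (order-> j<i)) (edge 0F pv (label-x j) tt (order-≡ j))
             (edge 1F (label-x j) pw tt (order-< j<k)) (λ ()) (λ ()) (λ ())
             (ends (edge 2F pu pw tt (order-> k<i)))
    ... | cs , growth = _ , cs , growth ,
      there (there (there (here refl))) ∷ there (there (here refl)) ∷ here refl ∷ []

  rainbow-colourable : RainbowColourable 3 graph 3
  rainbow-colourable = χ , sorted-triples-suffice χ λ u<v v<w →
    spanned refl refl refl (ordered u<v) (ordered v<w)

-- Edge counts and the bounds for even and odd orders

length-cartesianProductWith : (f : A → B → D) (xs : List A) (ys : List B) →
  length (cartesianProductWith f xs ys) ≡ length xs * length ys
length-cartesianProductWith f []       ys = refl
length-cartesianProductWith f (x ∷ xs) ys = trans (length-++ (map (f x) ys))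
  (cong₂ _+_ (length-map (f x) ys) (length-cartesianProductWith f xs ys))

length-allFin : ∀ n → length (allFin n) ≡ n
length-allFin n = length-tabulate id

-- The bounds on `t` need only an upper estimate, so it is enough to cover the edges by a list of
-- known length.
size-≤ : (G : Graph n) (ps : List (Fin n × Fin n)) →
  (∀ {u v} → u Fin.< v → Adj G u v → (u , v) ∈ˡ ps) → size G ≤ length ps
size-≤ G ps edge∈ps = Unique-⊆⇒length-≤ (edges-Unique G) λ e →
  let u<v , uv = ∈-edges⁻ G e in edge∈ps u<v uv

module Bipartite (m : ℕ) where

  label : Fin (m + m) → Label m
  label u = [ X , Y ]′ (splitAt m u)

  label-x : ∀ i → label (i ↑ˡ m) ≡ X i
  label-x i = cong [ X , Y ]′ (splitAt-↑ˡ m i m)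

  label-y : ∀ i → label (m ↑ʳ i) ≡ Y i
  label-y i = cong [ X , Y ]′ (splitAt-↑ʳ m m i)

  label-x⁻ : ∀ {u i} → label u ≡ X i → i ↑ˡ m ≡ u
  label-x⁻ {u} eq with splitAt m u in split
  label-x⁻ refl | inj₁ _ = splitAt⁻¹-↑ˡ split

  label-y⁻ : ∀ {u i} → label u ≡ Y i → m ↑ʳ i ≡ u
  label-y⁻ {u} eq with splitAt m u in split
  label-y⁻ refl | inj₂ _ = splitAt⁻¹-↑ʳ split

  label≢W : ∀ {u} → label u ≢ W
  label≢W {u} eq with splitAt m u
  label≢W () | inj₁ _
  label≢W () | inj₂ _

  ordered : ∀ {u v} → u Fin.< v → label u ≺ label v
  ordered {u} {v} u<v with label u in pu | label v in pv
  ... | W   | _   = contradiction pu label≢W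
  ... | _   | W   = contradiction pv label≢W
  ... | X i | Y j = X≺Y
  ordered u<v | X i | X j with refl ← label-x⁻ pu | refl ← label-x⁻ pv =
    X≺X (subst₂ ℕ._<_ (toℕ-↑ˡ i m) (toℕ-↑ˡ j m) u<v)
  ordered u<v | Y i | Y j with refl ← label-y⁻ pu | refl ← label-y⁻ pv =
    Y≺Y (ℕ.+-cancelˡ-< m _ _ (subst₂ ℕ._<_ (toℕ-↑ʳ m i) (toℕ-↑ʳ m j) u<v))
  ordered u<v | Y i | X j with refl ← label-y⁻ pu | refl ← label-x⁻ pv = contradiction
    (subst₂ ℕ._<_ (toℕ-↑ʳ m i) (toℕ-↑ˡ j m) u<v)
    (ℕ.≤⇒≯ (ℕ.≤-trans (ℕ.<⇒≤ (Fin.toℕ<n j)) (ℕ.m≤m+n m (toℕ i))))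

  labelling : Labelling (m + m) m
  labelling = record { x = _↑ˡ m ; y = m ↑ʳ_ ; label-x = label-x ; label-y = label-y ; ordered = ordered }

  joined⇒xy : ∀ {u v} → u Fin.< v → T (joined (label u) (label v)) →
    ∃₂ λ i j → i ↑ˡ m ≡ u × m ↑ʳ j ≡ v
  joined⇒xy {u} {v} u<v uv with label u in pu | label v in pv | ordered u<v
  ... | X i | Y j | X≺Y = i , j , label-x⁻ pu , label-y⁻ pv
  ... | W   | X _ | W≺X = contradiction pu label≢W
  ... | W   | Y _ | W≺Y = contradiction pu label≢W

  xy-pairs : List (Fin (m + m) × Fin (m + m))
  xy-pairs = cartesianProductWith (λ i j → i ↑ˡ m , m ↑ʳ j) (allFin m) (allFin m)

  length-xy-pairs : length xy-pairs ≡ m * m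
  length-xy-pairs = trans (length-cartesianProductWith _ (allFin m) (allFin m))
    (cong (λ k → k * k) (length-allFin m))

  ∈-xy-pairs : ∀ {u v} → u Fin.< v → T (joined (label u) (label v)) → (u , v) ∈ˡ xy-pairs
  ∈-xy-pairs u<v uv with joined⇒xy u<v uv
  ... | i , j , refl , refl = ∈-cartesianProductWith⁺ _ (∈-allFin i) (∈-allFin j)

  open Labelling labelling public using (graph; rainbow-colourable)

  graph-size : size graph ≤ m * m
  graph-size = subst (size graph ≤_) length-xy-pairs (size-≤ graph xy-pairs ∈-xy-pairs)

module Cone (m : ℕ) where
  module K = Bipartite m

  label : Fin (suc (m + m)) → Label m
  -- The apex comes first, where `W` is least for `_≺_`, and the remaining vertices keep their
  -- bipartite labels and order.
  label zero    = W
  label (suc u) = K.label u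

  ordered : ∀ {u v} → u Fin.< v → label u ≺ label v
  ordered {suc u} {suc v} (s≤s u<v) = K.ordered u<v
  ordered {zero}  {suc v} _ with K.label v in pv
  ... | W   = contradiction pv K.label≢W
  ... | X _ = W≺X
  ... | Y _ = W≺Y

  labelling : Labelling (suc (m + m)) m
  labelling = record { x = suc ∘ (_↑ˡ m) ; y = suc ∘ (m ↑ʳ_) ; label-x = K.label-x ; label-y = K.label-y
                     ; ordered = λ {u} {v} → ordered {u} {v} }

  open Labelling labelling public using (graph; rainbow-colourable)

  spokes rim : List (Fin (suc (m + m)) × Fin (suc (m + m)))
  spokes = map (λ v → zero , suc v) (allFin (m + m))
  rim    = map (λ (u , v) → suc u , suc v) K.xy-pairs

  length-pairs : length (spokes ++ rim) ≡ (m + m) + m * m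
  length-pairs = trans (length-++ spokes) (cong₂ _+_
    (trans (length-map _ (allFin (m + m))) (length-allFin (m + m)))
    (trans (length-map _ K.xy-pairs) K.length-xy-pairs))

  ∈-pairs : ∀ {u v} → u Fin.< v → T (joined (label u) (label v)) → (u , v) ∈ˡ spokes ++ rim
  ∈-pairs {zero}  {suc v} _         _  = ∈-++⁺ˡ (∈-map⁺ _ (∈-allFin v))
  ∈-pairs {suc u} {suc v} (s≤s u<v) uv = ∈-++⁺ʳ spokes (∈-map⁺ _ (K.∈-xy-pairs u<v uv))

  graph-size : size graph ≤ (m + m) + m * m
  graph-size = subst (size graph ≤_) length-pairs
    (size-≤ graph (spokes ++ rim) λ {u} {v} → ∈-pairs {u} {v})

t-even : ∀ m → 3 ≤ m + m → t[ m + m , 3 , 3 ]≤ ((m + m) ^ 2 / 4)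
t-even m 3≤n = t≤ 3≤n (Bipartite.graph m) (Bipartite.rainbow-colourable m)
  (ℕ.≤-trans (Bipartite.graph-size m) (ℕ.≤-reflexive (sym quarter)))
  where
  open +-*-Solver
  quarter : (m + m) ^ 2 / 4 ≡ m * m
  quarter = trans (cong (_/ 4) (solve 1 (λ m → (m :+ m) :^ 2 := m :* m :* con 4) refl m)) (m*n/n≡m (m * m) 4)

t-odd : ∀ m → 3 ≤ suc (m + m) →
  t[ suc (m + m) , 3 , 3 ]≤ ((suc (m + m) + 3) * (suc (m + m) ∸ 1) / 4)
t-odd m 3≤n = t≤ 3≤n (Cone.graph m) (Cone.rainbow-colourable m)
  (ℕ.≤-trans (Cone.graph-size m) (ℕ.≤-reflexive (sym quarter)))
  where
  open +-*-Solver
  quarter : (suc (m + m) + 3) * (m + m) / 4 ≡ (m + m) + m * m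
  quarter = trans (cong (_/ 4) (solve 1 (λ m →
      (con 1 :+ (m :+ m) :+ con 3) :* (m :+ m) := ((m :+ m) :+ m :* m) :* con 4) refl m))
    (m*n/n≡m ((m + m) + m * m) 4)

q*2≡q+q : ∀ q → q * 2 ≡ q + q
q*2≡q+q = solve 1 (λ q → q :* con 2 := q :+ q) refl
  where open +-*-Solver

odd-form : ∀ n → ¬ (2 ∣ n) → ∃ λ m → n ≡ suc (m + m)
odd-form n odd with n % 2 in rem | m%n<n n 2 | m≡m%n+[m/n]*n n 2
... | 0 | _ | _  = contradiction (m%n≡0⇒n∣m n 2 rem) odd
... | 1 | _ | eq = n / 2 , trans eq (cong suc (q*2≡q+q (n / 2)))
... | suc (suc _) | s≤s (s≤s ()) | _

-- Exact values for orders three to five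

t-value : ∀ {m} → 3 ≤ n → (G : Graph n) → RainbowColourable 3 G ℓ → size G ≡ m →
  (∀ M → RainbowColourable 3 (toGraph {n} M) ℓ → m ≤ size (toGraph M)) → t[ n , 3 , ℓ ]≡ m
t-value {n} {ℓ} {m} 3≤n G colourable refl bound = attains 3≤n G colourable , below
  where
  below : ∀ s → Attains n 3 ℓ s → m ≤ s
  below s attained with attains⁻ attained
  ... | M , colourable , refl = bound M colourable

3≤ : ∀ {k} → 3 ≤ 3 + k
3≤ = s≤s (s≤s (s≤s z≤n))

treeBound-connected : ∀ {m} → 3 ≤ n → {G : Graph n} → RainbowColourable 3 G c → TreeBound m G →
  (suc m ≤ size G) ⊎ (m ≤ size G × (∀ u v → Adj G u v → SubsetBridge G u v))
treeBound-connected 3≤n     colourable (inj₁ m<size)         = inj₁ m<size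
treeBound-connected 3≤n {G} colourable (inj₂ (inj₁ cut))     =
  contradiction cut (Connected⇒¬Cut {G = G} (colourable⇒Connected 3≤n colourable))
treeBound-connected 3≤n     colourable (inj₂ (inj₂ treelike)) = inj₂ treelike

treeBound⇒size≥ : ∀ {m} → 3 ≤ n → {G : Graph n} → RainbowColourable 3 G c → TreeBound m G → m ≤ size G
treeBound⇒size≥ 3≤n colourable bound =
  [ ℕ.<⇒≤ , proj₁ ]′ (treeBound-connected 3≤n colourable bound)

-- With fewer than `m` colours the tree case dies: at least `m` bridges would need pairwise distinct
-- colours.
treeBound⇒size> : ∀ {m} → 3 ≤ n → c ℕ.< m → {G : Graph n} → RainbowColourable 3 G c → TreeBound m G →
  m ℕ.< size G
treeBound⇒size> 3≤n c<m {G} colourable bound with treeBound-connected 3≤n colourable bound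
... | inj₁ m<size             = m<size
... | inj₂ (m≤size , bridges) = contradiction
  (ℕ.≤-trans m≤size (bridges⇒size-≤ 3≤n colourable λ u v uv → toBridge (bridges u v uv)))
  (ℕ.<⇒≱ c<m)
  where
  toBridge : ∀ {u v} → SubsetBridge G u v → IsBridge G u v
  toBridge (A , u≢v , only) = Vec.lookup A , u≢v , λ {p} {q} → only p q

t-332 : t[ 3 , 3 , 2 ]≡ 2
t-332 = t-value 3≤ (picturedGraph path₃) (picturedColouring path₃ , path₃-rainbow) refl
  λ M colourable → treeBound⇒size≥ 3≤ colourable (treeBound₃ M)

t-432 : t[ 4 , 3 , 2 ]≡ 4
t-432 = t-value 3≤ (picturedGraph cycle₄) (picturedColouring cycle₄ , cycle₄-rainbow) refl
  λ M (χ , rc) → twoEdgesPerTriple₄ M λ _ _ _ → TwoColours.two-edges 3≤ χ rc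

-- Complete graphs of the same order agree pointwise, and `5 C 2` and the size of the graph of
-- `complete₅` both evaluate to ten. That this graph is complete is read off from its own
-- two-colouring.
complete₅-size : {G : Graph 5} → (∀ {u v} → u ≢ v → Adj G u v) → 5 C 2 ≡ size G
complete₅-size {G} complete = size-cong {G = picturedGraph complete₅} {G} agree
  where
  both : ∀ {a b} → T a → T b → a ≡ b
  both {true} {true} _ _ = refl
  agree : picturedGraph complete₅ ≈ G
  agree u v with u Fin.≟ v
  ... | yes refl = trans (irrefl (picturedGraph complete₅) u) (sym (irrefl G u))
  ... | no u≢v = both (complete-if-two-coloured (picturedColouring complete₅ , complete₅-rainbow) u≢v)
    (complete u≢v)

t-532 : t[ 5 , 3 , 2 ]≡ (5 C 2)
t-532 = t-value 3≤ (picturedGraph complete₅) (picturedColouring complete₅ , complete₅-rainbow) refl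
  λ M colourable → ℕ.≤-reflexive (complete₅-size {toGraph M} (complete-if-two-coloured colourable))

t-333 : t[ 3 , 3 , 3 ]≡ 2
t-333 = t-value 3≤ (picturedGraph path₃)
  (colourable-mono (ℕ.n≤1+n 2) (picturedColouring path₃ , path₃-rainbow)) refl
  λ M colourable → treeBound⇒size≥ 3≤ colourable (treeBound₃ M)

t-433 : t[ 4 , 3 , 3 ]≡ 3
t-433 = t-value 3≤ (picturedGraph star₄) (picturedColouring star₄ , star₄-rainbow) refl
  λ M colourable → treeBound⇒size≥ 3≤ colourable (treeBound₄ M)

t-533 : t[ 5 , 3 , 3 ]≡ 5
t-533 = t-value 3≤ (picturedGraph cycle₅) (picturedColouring cycle₅ , cycle₅-rainbow) refl
  λ M colourable → treeBound⇒size> 3≤ ℕ.≤-refl colourable (treeBound₅ M)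

proposition2p1 : (n : ℕ) → 3 ≤ n →
    ( (t[ 3 , 3 , 2 ]≡ 2)
    × (t[ 4 , 3 , 2 ]≡ 4)
    × (t[ 5 , 3 , 2 ]≡ (5 C 2))
    × (6 ≤ n → ¬ (Σ[ G ∈ Graph n ] (Connected G × (rx[ 3 ] G ≤ 2)))) )
    ×
    ( (t[ 3 , 3 , 3 ]≡ 2)
    × (t[ 4 , 3 , 3 ]≡ 3)
    × (t[ 5 , 3 , 3 ]≡ 5)
    × (6 ≤ n →
    (2 ∣ n → t[ n , 3 , 3 ]≤ ((n ^ 2) / 4))
    × (¬ (2 ∣ n) → t[ n , 3 , 3 ]≤ (((n + 3) * (n ∸ 1)) / 4))) )
proposition2p1 n 3≤n =
  (t-332 , t-432 , t-532 , λ 6≤n (G , _ , rx≤2) → no-two-colouring 6≤n (rx≤⇒colourable rx≤2)) ,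
  (t-333 , t-433 , t-533 , λ _ → even , odd)
  where
  even : 2 ∣ n → t[ n , 3 , 3 ]≤ ((n ^ 2) / 4)
  even (divides q n≡q*2) with refl ← trans n≡q*2 (q*2≡q+q q) = t-even q 3≤n
  odd : ¬ (2 ∣ n) → t[ n , 3 , 3 ]≤ (((n + 3) * (n ∸ 1)) / 4)
  odd 2∤n with odd-form n 2∤n
  ... | m , refl = t-odd m 3≤n
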